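{- The Water-Filling algorithm is $(2-\sqrt2)$-competitive for fractional fully online matching on general (not necessarily bipartite) graphs, and this ratio is tight for Water-Filling. That is: on every instance, Water-Filling outputs a fractional matching of total value at least $(2-\sqrt2)\cdot\mathrm{OPT}(G)$, and for every $\Gamma>2-\sqrt2$ the Water-Filling algorithm is not $\Gamma$-competitive.
   Context: **Fractional fully online matching.** An instance is a finite simple graph $G=(V,E)$ in which each vertex $v$ has an arrival time $r_v$ and a deadline $d_v\ge r_v$; $v$ is available during $[r_v,d_v]$. Two vertices $u,v$ may be adjacent only if $[r_u,d_u]$ and $[r_v,d_v]$ intersect. Arrivals and deadlines are processed one at a time in chronological order (simultaneous events in some fixed order in which both endpoints of every edge have arrived before either of them reaches its deadline). When $v$ arrives, the edges from $v$ to previously arrived vertices are revealed. An algorithm maintains values $x_{uv}\ge 0$, $(u,v)\in E$, initially $0$, subject to $x_u:=\sum_{v:(u,v)\in E}x_{uv}\le 1$ for all $u$; it may only increase $x_{uv}$, and only while both $u$ and $v$ are available. When $v$ reaches its deadline the algorithm is notified, and this is the last opportunity to match $v$. The value of the output is $\sum_{(u,v)\in E}x_{uv}$. $\mathrm{OPT}(G)$ is the maximum of $\sum_{(u,v)\in E}x_{uv}$ over all $x\ge0$ with $\sum_{v:(u,v)\in E}x_{uv}\le1$ for all $u$. An algorithm is $\Gamma$-competitive if on every instance its output has value at least $\Gamma\cdot\mathrm{OPT}(G)$. **Water-Filling algorithm.** The number $x_u$ is called the water level of $u$. The algorithm acts only at deadlines. At the deadline of a vertex $u$, let $N(u)$ be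 the set of neighbors of $u$ that are currently available. While $x_u<1$ and $\min_{w\in N(u)}x_w<1$, continuously increase $x_{uv}$ for the neighbor $v\in N(u)$ with the lowest current water level (neighbors tied at the lowest level are raised together at equal rate). Equivalently, for a suitable level $\lambda$, every $v\in N(u)$ has its water level raised to $\max\{x_v,\lambda\}$ (the increase of $x_v$ being put on the edge $(u,v)$), where $\lambda\le 1$ is such that the total increase equals $\min\{1-x_u,\sum_{v\in N(u)}(1-x_v)\}$. -}

module Defs where

open import Algebra.Bundles using (CommutativeRing)
open import Algebra.Structures using (IsCommutativeRing)
import Algebra.Construct.NaturalChoice.Max as Max
import Algebra.Construct.NaturalChoice.Min as Min
import Algebra.Definitions.RawMonoid as RawMonoidDefs
import Algebra.Properties.CommutativeMonoid.Sum as Sum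
open import Data.Bool.Base using (if_then_else_)
open import Data.Fin.Base as Fin using (Fin; zero; suc; inject₁; fromℕ)
open import Data.Fin.Properties as Fin using ()
open import Data.Nat.Base as ℕ using (ℕ)
open import Data.Product.Base using (∃; ∃-syntax; _×_; _,_)
open import Function.Bundles using (_↔_; Inverse)
open import Level using (0ℓ)
open import Relation.Binary.Bundles using (DecTotalOrder)
open import Relation.Binary.Core using (Rel)
open import Relation.Binary.Definitions using (Decidable; Irreflexive; Symmetric)
open import Relation.Binary.PropositionalEquality.Core using (_≡_; _≢_)
import Relation.Binary.Construct.NonStrictToStrict as Strict
open import Relation.Binary.Structures using (IsDecTotalOrder)
open import Relation.Nullary.Decidable.Core using (Dec; does; _×-dec_)
open import Relation.Nullary.Negation.Core using (¬_)

-- The number system: an Archimedean ordered field in which 2 has a square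
-- root.  Classically ℝ is one.  Completeness is not assumed.
record RealField : Set₁ where
  infix  4 _≤_
  infixl 6 _+_
  infixl 7 _*_
  infix  8 -_
  field
    Carrier : Set
    _≤_     : Rel Carrier 0ℓ
    _+_ _*_ : Carrier → Carrier → Carrier
    -_      : Carrier → Carrier
    0# 1#   : Carrier
    isCommutativeRing : IsCommutativeRing _≡_ _+_ _*_ -_ 0# 1#
    isDecTotalOrder   : IsDecTotalOrder _≡_ _≤_
    0≢1        : 0# ≢ 1#
    inverse    : ∀ x → x ≢ 0# → ∃[ y ] x * y ≡ 1#
    +-monoˡ-≤  : ∀ z {x y} → x ≤ y → x + z ≤ y + z
    *-nonNeg   : ∀ {x y} → 0# ≤ x → 0# ≤ y → 0# ≤ x * y

  commutativeRing : CommutativeRing 0ℓ 0ℓ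
  commutativeRing = record { isCommutativeRing = isCommutativeRing }

  decTotalOrder : DecTotalOrder 0ℓ 0ℓ 0ℓ
  decTotalOrder = record { isDecTotalOrder = isDecTotalOrder }

  open CommutativeRing commutativeRing public
    using (_-_; +-commutativeMonoid; +-rawMonoid)
  open DecTotalOrder decTotalOrder public using (totalOrder)
  open RawMonoidDefs +-rawMonoid public using () renaming (_×_ to _·_)
  open Strict _≡_ _≤_ public using (_<_)
  open Max totalOrder public using (_⊔_)
  open Min totalOrder public using (_⊓_)
  open Sum +-commutativeMonoid public using (sum; sum-syntax)

  2# : Carrier
  2# = 1# + 1#

  field
    archimedean : ∀ x → ∃[ k ] x ≤ k · 1#
    √2          : Carrier
    0≤√2        : 0# ≤ √2
    √2*√2≡2     : √2 * √2 ≡ 2#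

record SimpleGraph (n : ℕ) : Set₁ where
  infix 4 _~_ _~?_
  field
    _~_      : Rel (Fin n) 0ℓ
    _~?_     : Decidable _~_
    ~-sym    : Symmetric _~_
    ~-irrefl : Irreflexive _≡_ _~_

data Event (n : ℕ) : Set where
  arrival deadline : Fin n → Event n

eventTime : ∀ {n} {T : Set} (r d : Fin n → T) → Event n → T
eventTime r d (arrival v)  = r v
eventTime r d (deadline v) = d v

module FullyOnlineMatching (ℝ : RealField) where

  open RealField ℝ

  -- An edge weighting is stored as a symmetric matrix that vanishes off the
  -- edges (see IsFractionalMatching), so each edge appears twice.
  EdgeValues : ℕ → Set
  EdgeValues n = Fin n → Fin n → Carrier

  level : ∀ {n} → EdgeValues n → Fin n → Carrier
  level {n} x u = ∑[ v < n ] x u v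

  -- Restricting to u < v counts every undirected edge once.
  value : ∀ {n} → EdgeValues n → Carrier
  value {n} x =
    ∑[ u < n ] ∑[ v < n ] (if does (u Fin.<? v) then x u v else 0#)

  record IsFractionalMatching {n} (G : SimpleGraph n) (x : EdgeValues n) : Set where
    open SimpleGraph G
    field
      symmetric : ∀ u v → x u v ≡ x v u
      support   : ∀ u v → ¬ (u ~ v) → x u v ≡ 0#
      nonNeg    : ∀ u v → 0# ≤ x u v
      level≤1   : ∀ u → level x u ≤ 1#

  record IsOPT {n} (G : SimpleGraph n) (opt : Carrier) : Set where
    field
      attained   : ∃[ x ] IsFractionalMatching G x × value x ≡ opt
      upperBound : ∀ x → IsFractionalMatching G x → value x ≤ opt

  -- The processing order of the 2n events is part of the instance; at
  -- simultaneous events it records the chosen tie-breaking.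
  record Instance : Set₁ where
    field
      n     : ℕ
      graph : SimpleGraph n
    open SimpleGraph graph public
    field
      r d       : Fin n → Carrier
      r≤d       : ∀ v → r v ≤ d v
      intersect : ∀ {u v} → u ~ v →
                  ∃[ t ] (r u ≤ t × t ≤ d u) × (r v ≤ t × t ≤ d v)

    time : Event n → Carrier
    time = eventTime r d

    field
      schedule : Fin (n ℕ.+ n) ↔ Event n

    event : Fin (n ℕ.+ n) → Event n
    event = Inverse.to schedule

    position : Event n → Fin (n ℕ.+ n)
    position = Inverse.from schedule

    field
      chronological : ∀ {i j} → i Fin.≤ j → time (event i) ≤ time (event j)
      arrivalsFirst : ∀ {u v} → u ~ v →
                      position (arrival u) Fin.< position (deadline u) ×
                      position (arrival u) Fin.< position (deadline v)

    -- A vertex is still available while its own deadline is being processed.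
    Available : Fin (n ℕ.+ n) → Fin n → Set
    Available i v = position (arrival v) Fin.≤ i × i Fin.≤ position (deadline v)

    available? : ∀ i v → Dec (Available i v)
    available? i v =
      (position (arrival v) Fin.≤? i) ×-dec (i Fin.≤? position (deadline v))

    AvailableNeighbour : Fin (n ℕ.+ n) → Fin n → Fin n → Set
    AvailableNeighbour i u v = u ~ v × Available i v

    availableNeighbour? : ∀ i u v → Dec (AvailableNeighbour i u v)
    availableNeighbour? i u v = (u ~? v) ×-dec available? i v

  -- A history of the values maintained by an algorithm that obeys the rules
  -- of the model; processing event i leads from x (inject₁ i) to x (suc i).
  record Run (I : Instance) : Set where
    open Instance I
    field
      x             : Fin (ℕ.suc (n ℕ.+ n)) → EdgeValues n
      initial       : ∀ u v → x zero u v ≡ 0#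
      feasible      : ∀ t → IsFractionalMatching graph (x t)
      increasing    : ∀ i u v → x (inject₁ i) u v ≤ x (suc i) u v
      onlyAvailable : ∀ i u v → x (inject₁ i) u v ≢ x (suc i) u v →
                      Available i u × Available i v

    output : EdgeValues n
    output = x (fromℕ (n ℕ.+ n))

  -- An algorithm is given by the runs it can produce.
  Algorithm : Set₁
  Algorithm = ∀ {I} → Run I → Set

  Competitive : Algorithm → Carrier → Set₁
  Competitive A Γ =
    ∀ (I : Instance) (ρ : Run I) → A ρ →
    ∀ opt → IsOPT (Instance.graph I) opt → Γ * opt ≤ value (Run.output ρ)

  module _ (I : Instance) where
    open Instance I

    ∑N : Fin (n ℕ.+ n) → Fin n → (Fin n → Carrier) → Carrier
    ∑N i u f =
      ∑[ v < n ] (if does (availableNeighbour? i u v) then f v else 0#)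

    -- x′ results from x by water-filling from u up to level ℓ.
    record FillsTo (i : Fin (n ℕ.+ n)) (u : Fin n) (x x′ : EdgeValues n)
                   (ℓ : Carrier) : Set where
      rise : Fin n → Carrier
      rise v = (level x v ⊔ ℓ) - level x v
      field
        ℓ≤1        : ℓ ≤ 1#
        raised     : ∀ v → AvailableNeighbour i u v →
                     x′ u v ≡ x u v + rise v × x′ v u ≡ x v u + rise v
        unchanged  : ∀ v w → ¬ (v ≡ u × AvailableNeighbour i u w) →
                     ¬ (w ≡ u × AvailableNeighbour i u v) → x′ v w ≡ x v w
        total      : ∑N i u rise ≡
                     (1# - level x u) ⊓ ∑N i u (λ v → 1# - level x v)

    WaterFillingStep : Fin (n ℕ.+ n) → Event n → EdgeValues n → EdgeValues n → Set
    WaterFillingStep i (arrival _)  x x′ = ∀ u v → x′ u v ≡ x u v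
    WaterFillingStep i (deadline u) x x′ = ∃[ ℓ ] FillsTo i u x x′ ℓ

  WaterFilling : Algorithm
  WaterFilling {I} ρ =
    ∀ i → WaterFillingStep I i (event i) (x (inject₁ i)) (x (suc i))
    where
    open Instance I
    open Run ρ

{-# OPTIONS --safe #-}

-- Upper bound: when the level of a neighbour passes y, split each unit of
-- value between it and the vertex with the deadline as φ(y) : 1 − φ(y), where
-- φ(y) = 1 − 1/√2 + y/√2.  For an edge whose first deadline finds its vertex
-- at level p and leaves the neighbour at level m, both ends together receive
-- at least 2 − √2 plus a multiple of (p + m − (2 − √2))², and weak duality
-- concludes.
--
-- Tightness: almost every pair of an optimal matching must satisfy
-- p + m ≈ 2 − √2.  The vertices come in generations; in each, groups of
-- servers with decreasing levels jointly raise the next generation by 1/L per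
-- group, and after each group some future servers and some clients leave the
-- common level.  The group sizes of a steady state of this process solve a
-- linear recurrence, which has an exact integral solution for 2E² = K(K + 1),
-- with L = E + K + 1.  Each pair of a server and a client of the same group
-- then has total passive level (K + 1)/L, which tends to 2 − √2.

module Submission where

import Algebra.Construct.NaturalChoice.Max as Max
import Algebra.Construct.NaturalChoice.Min as Min
import Algebra.Properties.Ring as RingProperties
import Algebra.Properties.Semiring.Mult as UnaryMult
import Algebra.Properties.Semiring.Mult.TCOptimised as Mult
import Algebra.Properties.Semiring.Sum as SemiringSum
import Algebra.Solver.Ring as RingSolver
open import Algebra.Bundles using (CommutativeRing)
open import Algebra.Solver.Ring.AlmostCommutativeRing using (AlmostCommutativeRing; fromCommutativeRing; _-Raw-AlmostCommutative⟶_)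
open import Data.Bool.Base using (if_then_else_)
open import Data.Empty using (⊥)
open import Data.Fin.Base as Fin using (Fin; zero; suc; inject₁; fromℕ; toℕ; opposite; _↑ˡ_; _↑ʳ_)
import Data.Fin.Induction as Fin
import Data.Fin.Permutation as Permutation
import Data.Fin.Properties as Fin
open import Data.Integer.Base as ℤ using (ℤ; -[1+_]; _⊖_)
import Data.Integer.Properties as ℤ
open import Data.List.Base as List using (List; []; _∷_; _++_)
import Data.List.Membership.Propositional.Properties as List
open import Data.List.Relation.Unary.All as All using (All; []; _∷_)
import Data.List.Relation.Unary.All.Properties as All
open import Data.List.Relation.Unary.AllPairs as AllPairs using (AllPairs; []; _∷_)
import Data.List.Relation.Unary.AllPairs.Properties as AllPairs
open import Data.Maybe.Base using (Maybe; just; nothing)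
open import Data.Nat.Base as ℕ using (ℕ; zero; suc)
import Data.Nat.Properties as ℕ
open import Data.Product.Base using (∃-syntax; _×_; _,_; proj₁; proj₂)
open import Data.Sum.Base using (_⊎_; inj₁; inj₂; swap)
open import Function.Bundles using (Inverse; _↔_; mk↔ₛ′)
open import Function.Construct.Composition using (_↔-∘_)
open import Relation.Binary.Bundles using (DecTotalOrder)
open import Relation.Binary.Definitions using (tri<; tri≈; tri>)
open import Relation.Binary.PropositionalEquality
open import Relation.Nullary.Decidable.Core using (Dec; yes; no; does; _×-dec_; _⊎-dec_)
open import Relation.Nullary.Negation.Core using (¬_; contradiction)
open import Defs

open ≡-Reasoning

-- The vertex with the deadline may itself have been raised before, to level p. In the scale where a
-- unit of value is 4, what it keeps for filling up is at least 2√2 (1 - p)(1 - m). The cross term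
-- 2√2 p m completes the terms √2 p² and √2 m² of the two passive shares to √2 (p + m)²; this is
-- what the slope 1/√2 of φ achieves.
--
-- The tight line p + m = 2 - √2 is irrational while the passive levels are multiples of 1/L, hence
-- a sequence of instances. With z = E + a + 1 and D = 2E + K + 1 the steady state reads (z - 1)
-- f(z) = f(D - z) + (z + 1) f(z + 1). The function of which `count` is a multiple solves this for
-- all E and K; the quadratic equation says that it vanishes at z = L, so that nobody is left after
-- the last group.
--
-- Generation 0 has smaller groups at level 0, and the optimum leaves the servers of the last
-- generation unmatched; many generations make these boundary effects small. Tightness also needs a
-- run to exist. As the field need not be complete, the water level is found by solving piecewise
-- affine equations.

module SquareTriangularNumbers where
  open import Data.Nat.Base
  open import Data.Nat.Divisibility using (∣-trans; m≤n⇒m!∣n!; m∣m*n)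
  open import Data.Nat.DivMod using (m*[n/m]≡n)
  open import Data.Nat.Properties
  open import Data.Nat.Solver using (module +-*-Solver)
  open +-*-Solver

  toℕ+opposite : ∀ {K} (i : Fin K) → toℕ i + suc (toℕ (opposite i)) ≡ K
  toℕ+opposite {K} i = begin
    toℕ i + suc (toℕ (opposite i)) ≡⟨ +-suc (toℕ i) _ ⟩
    suc (toℕ i) + toℕ (opposite i) ≡⟨ cong (suc (toℕ i) +_) (Fin.opposite-prop i) ⟩
    suc (toℕ i) + (K ∸ suc (toℕ i)) ≡⟨ m+[n∸m]≡n (Fin.toℕ<n i) ⟩
    K ∎

  -- The Pell equation 2E² = K(K + 1)

  record SquareTriangular (E K : ℕ) : Set where
    field
      1≤E  : 1 ≤ E
      1≤K  : 1 ≤ K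
      pell : 2 * (E * E) ≡ K * suc K

  -- For X = 2K + 1 and Y = 2E the equation is X² - 2Y² = 1, and the new pair comes from multiplying
  -- X + Y√2 by the unit 3 + 2√2.
  nextSquareTriangular : ∀ {E K} → SquareTriangular E K → SquareTriangular (3 * E + 2 * K + 1) (4 * E + 3 * K + 1)
  nextSquareTriangular {E} {K} ST = record
    { 1≤E = m≤n+m 1 (3 * E + 2 * K)
    ; 1≤K = m≤n+m 1 (4 * E + 3 * K)
    ; pell = +-cancelʳ-≡ (K * suc K) _ _ (trans
        (solve 2 (λ E K →
           con 2 :* ((con 3 :* E :+ con 2 :* K :+ con 1) :* (con 3 :* E :+ con 2 :* K :+ con 1)) :+ K :* (con 1 :+ K)
           := (con 4 :* E :+ con 3 :* K :+ con 1) :* (con 1 :+ (con 4 :* E :+ con 3 :* K :+ con 1)) :+ con 2 :* (E :* E))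
          refl E K)
        (cong ((4 * E + 3 * K + 1) * suc (4 * E + 3 * K + 1) +_) pell)) }
    where open SquareTriangular ST

  largeSquareTriangular : ∀ m → ∃[ E ] ∃[ K ] m ≤ E × SquareTriangular E K
  largeSquareTriangular zero = 1 , 1 , z≤n , record { 1≤E = ≤-refl ; 1≤K = ≤-refl ; pell = refl }
  largeSquareTriangular (suc m) with largeSquareTriangular m
  ... | E , K , m≤E , ST = _ , _ , grows , nextSquareTriangular ST
    where
    grows : suc m ≤ 3 * E + 2 * K + 1
    grows = ≤-trans (s≤s (≤-trans m≤E (≤-trans (m≤m+n E _) (m≤m+n (3 * E) (2 * K))))) (≤-reflexive (+-comm 1 _))

  -- Integral group sizes of the steady state

  module Counts {E K : ℕ} (ST : SquareTriangular E K) where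
    open SquareTriangular ST

    L : ℕ
    L = suc (E + K)

    -- The multiple L! of 1/z, integral for 1 ≤ z ≤ L. All denominators in the group sizes lie in
    -- this range, so three such factors clear them at once. The value at 0 is a dummy.
    reciprocal : ℕ → ℕ
    reciprocal zero    = 0
    reciprocal (suc z) = (L !) / suc z

    reciprocal-* : ∀ {z} → 1 ≤ z → z ≤ L → z * reciprocal z ≡ L !
    reciprocal-* {suc z} _ z≤L = m*[n/m]≡n (∣-trans (m∣m*n (z !)) (m≤n⇒m!∣n! z≤L))

    reciprocal-pos : ∀ {z} → 1 ≤ z → z ≤ L → 1 ≤ reciprocal z
    reciprocal-pos {z} 1≤z z≤L with reciprocal z in eq
    ... | suc _ = s≤s z≤n
    ... | zero  = contradiction (trans (sym (reciprocal-* 1≤z z≤L)) (trans (cong (z *_) eq) (*-zeroʳ z)))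
                    (≢-nonZero⁻¹ (L !) {{>-nonZero (1≤n! L)}})

    -- For a + r = K, z = suc (E + a) and D = 2E + K + 1, this is the multiple
    -- (L !)³/2 of D/(z (z − 1)) + 1/z − 1/(D − z).
    count : ℕ → ℕ → ℕ
    count a r = r * (2 * E + K + suc a) * (reciprocal (suc (E + a)) * reciprocal (E + a) * reciprocal (E + r))

    count-pos : ∀ {a r} → a + r ≤ K → 1 ≤ r → 1 ≤ count a r
    count-pos {a} {r} a+r≤K 1≤r = *-mono-≤ (*-mono-≤ 1≤r (≤-trans (s≤s z≤n) (m≤n+m (suc a) (2 * E + K))))
      (*-mono-≤ (*-mono-≤ (reciprocal-pos (s≤s z≤n) (s≤s E+a≤))
                          (reciprocal-pos (≤-trans 1≤E (m≤m+n E a)) (m≤n⇒m≤1+n E+a≤)))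
                (reciprocal-pos (≤-trans 1≤E (m≤m+n E r)) (m≤n⇒m≤1+n (+-monoʳ-≤ E (≤-trans (m≤n+m r a) a+r≤K)))))
      where
      E+a≤ : E + a ≤ E + K
      E+a≤ = +-monoʳ-≤ E (≤-trans (m≤m+n a r) a+r≤K)

    private
      -- The recurrence below with its denominators removed. Its sides differ by exactly 2E² - K(K +
      -- 1): the factored form of `count`, whose factor `r` makes the size vanish at the end,
      -- satisfies the recurrence thanks to `pell`.
      polynomial-identity : ∀ a r → K ≡ a + suc r →
        suc r * (2 * E + K + suc a) * (E + r) ≡
        suc a * (2 * E + K + suc r) + r * (2 * E + K + suc (suc a)) * suc (E + r)
      polynomial-identity a r K≡ = +-cancelʳ-≡ (K * suc K) _ _ (trans expanded
        (cong (suc a * (2 * E + K + suc r) + r * (2 * E + K + suc (suc a)) * suc (E + r) +_) pell))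
        where
        expanded : suc r * (2 * E + K + suc a) * (E + r) + K * suc K ≡
          suc a * (2 * E + K + suc r) + r * (2 * E + K + suc (suc a)) * suc (E + r) + 2 * (E * E)
        expanded rewrite K≡ = solve 3 (λ E a r →
          let K = a :+ (con 1 :+ r) in
          (con 1 :+ r) :* (con 2 :* E :+ K :+ (con 1 :+ a)) :* (E :+ r) :+ K :* (con 1 :+ K)
          := (con 1 :+ a) :* (con 2 :* E :+ K :+ (con 1 :+ r))
             :+ r :* (con 2 :* E :+ K :+ (con 2 :+ a)) :* (con 1 :+ (E :+ r)) :+ con 2 :* (E :* E))
          refl E a r

    -- Conservation of vertices: of those raised in step a, the ones counted
    -- by count a (suc r) and count r (suc a) leave before the next step.
    count-recurrence : ∀ a r → a + suc r ≡ K →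
      suc (E + a) * count a (suc r) ≡
      count a (suc r) + count r (suc a) + suc (E + suc a) * count (suc a) r
    count-recurrence a r a+r+1≡K = begin
      suc (E + a) * count a (suc r)
        ≡⟨⟩
      count a (suc r) + (E + a) * count a (suc r)
        ≡⟨ cong (count a (suc r) +_) (begin
          (E + a) * (p * (hA * hB * hR))
            ≡⟨ solve 5 (λ z p x y w → z :* (p :* (x :* y :* w)) := p :* (z :* y) :* (x :* w)) refl (E + a) p hA hB hR ⟩
          p * ((E + a) * hB) * (hA * hR)
            ≡⟨ cong (λ h → p * h * (hA * hR)) (trans hB* (sym hr*)) ⟩
          p * ((E + r) * hr) * (hA * hR)
            ≡⟨ solve 5 (λ p z y x w → p :* (z :* y) :* (x :* w) := p :* z :* (x :* w :* y)) refl p (E + r) hr hA hR ⟩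
          p * (E + r) * (hA * hR * hr)
            ≡⟨ cong (_* (hA * hR * hr)) (polynomial-identity a r (sym a+r+1≡K)) ⟩
          (p′ + p″ * suc (E + r)) * (hA * hR * hr)
            ≡⟨ solve 6 (λ p′ p″ z x w y → (p′ :+ p″ :* z) :* (x :* w :* y) := p′ :* (w :* y :* x) :+ p″ :* (z :* w) :* (x :* y)) refl p′ p″ (suc (E + r)) hA hR hr ⟩
          p′ * (hR * hr * hA) + p″ * (suc (E + r) * hR) * (hA * hr)
            ≡⟨ cong (λ h → p′ * (hR * hr * hA) + p″ * h * (hA * hr)) (trans hR* (sym hC*)) ⟩
          p′ * (hR * hr * hA) + p″ * (suc (E + suc a) * hC) * (hA * hr)
            ≡⟨ cong (p′ * (hR * hr * hA) +_) (solve 5 (λ p z c x y → p :* (z :* c) :* (x :* y) := z :* (p :* (c :* x :* y))) refl p″ (suc (E + suc a)) hC hA hr) ⟩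
          p′ * (hR * hr * hA) + suc (E + suc a) * (p″ * (hC * hA * hr)) ∎) ⟩
      count a (suc r) + (p′ * (hR * hr * hA) + suc (E + suc a) * (p″ * (hC * hA * hr)))
        ≡⟨ cong₂ (λ h h′ → count a (suc r) + (p′ * h + suc (E + suc a) * (p″ * h′))) reorder reorder′ ⟩
      count a (suc r) + (count r (suc a) + suc (E + suc a) * count (suc a) r)
        ≡⟨ +-assoc (count a (suc r)) _ _ ⟨
      count a (suc r) + count r (suc a) + suc (E + suc a) * count (suc a) r ∎
      where
      p p′ p″ hA hB hC hR hr : ℕ
      p  = suc r * (2 * E + K + suc a)
      p′ = suc a * (2 * E + K + suc r)
      p″ = r * (2 * E + K + suc (suc a))
      hA = reciprocal (suc (E + a))
      hB = reciprocal (E + a)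
      hC = reciprocal (suc (E + suc a))
      hR = reciprocal (E + suc r)
      hr = reciprocal (E + r)
      E+x≤ : ∀ {x} → x ≤ K → E + x ≤ E + K
      E+x≤ = +-monoʳ-≤ E
      1≤E+ : ∀ x → 1 ≤ E + x
      1≤E+ x = ≤-trans 1≤E (m≤m+n E x)
      a<K : suc a ≤ K
      a<K = subst (suc a ≤_) (trans (sym (+-suc a r)) a+r+1≡K) (s≤s (m≤m+n a r))
      r<K : suc r ≤ K
      r<K = subst (suc r ≤_) a+r+1≡K (m≤n+m (suc r) a)
      hB* : (E + a) * hB ≡ L !
      hB* = reciprocal-* (1≤E+ a) (m≤n⇒m≤1+n (E+x≤ (<⇒≤ a<K)))
      hC* : suc (E + suc a) * hC ≡ L !
      hC* = reciprocal-* (s≤s z≤n) (s≤s (E+x≤ a<K))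
      hR* : suc (E + r) * hR ≡ L !
      hR* = trans (cong (_* hR) (sym (+-suc E r))) (reciprocal-* (1≤E+ (suc r)) (m≤n⇒m≤1+n (E+x≤ r<K)))
      hr* : (E + r) * hr ≡ L !
      hr* = reciprocal-* (1≤E+ r) (m≤n⇒m≤1+n (E+x≤ (<⇒≤ r<K)))
      reorder : hR * hr * hA ≡ reciprocal (suc (E + r)) * reciprocal (E + r) * reciprocal (E + suc a)
      reorder = cong₂ (λ y z → reciprocal y * hr * reciprocal z) (+-suc E r) (sym (+-suc E a))
      reorder′ : hC * hA * hr ≡ reciprocal (suc (E + suc a)) * reciprocal (E + suc a) * reciprocal (E + r)
      reorder′ = cong (λ z → hC * reciprocal z * hr) (sym (+-suc E a))

    -- `width i` is L times the room 1 - (K - i)/L of a server of group i. The factor L in `pool`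
    -- lets generation 0 do with `width i * stock i` servers, that is, `width i * pool i` divided by
    -- L.
    stock pool width : Fin K → ℕ
    stock i = count (toℕ i) (suc (toℕ (opposite i)))
    pool i  = L * stock i
    width i = suc (E + toℕ i)

    width-*-pool : ∀ i → width i * pool i ≡ L * (width i * stock i)
    width-*-pool i = solve 3 (λ w l s → w :* (l :* s) := l :* (w :* s)) refl (width i) L (stock i)

    -- The number of vertices that group a raises. It lives on ℕ, with `K ∸ a` in place of an index
    -- reversal, so that it has a value at K, where the telescoping ends.
    flow : ℕ → ℕ
    flow a = suc (E + a) * (L * count a (K ∸ a))

    flow-toℕ : ∀ i → flow (toℕ i) ≡ width i * pool i
    flow-toℕ i = cong (λ r → width i * (L * count (toℕ i) r))
      (trans (cong (_∸ toℕ i) (sym (toℕ+opposite i))) (m+n∸m≡n (toℕ i) _))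

    flow-end : flow K ≡ 0
    flow-end = trans (cong (λ r → suc (E + K) * (L * count K r)) (n∸n≡0 K))
      (trans (cong (suc (E + K) *_) (*-zeroʳ L)) (*-zeroʳ (suc (E + K))))

    flow-recurrence : ∀ i → pool (opposite i) + pool i + flow (suc (toℕ i)) ≡ flow (toℕ i)
    flow-recurrence i = begin
      pool (opposite i) + pool i + flow (suc a)
        ≡⟨ cong₂ (λ b s → L * count r (suc b) + pool i + suc (E + suc a) * (L * count (suc a) s))
             (cong toℕ (Fin.opposite-involutive i)) (sym (Fin.opposite-prop i)) ⟩
      L * count r (suc a) + L * count a (suc r) + suc (E + suc a) * (L * count (suc a) r)
        ≡⟨ solve 5 (λ l p q z s → l :* p :+ l :* q :+ z :* (l :* s) := l :* (q :+ p :+ z :* s))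
             refl L (count r (suc a)) (count a (suc r)) (suc (E + suc a)) (count (suc a) r) ⟩
      L * (count a (suc r) + count r (suc a) + suc (E + suc a) * count (suc a) r)
        ≡⟨ cong (L *_) (count-recurrence a r (toℕ+opposite i)) ⟨
      L * (suc (E + a) * count a (suc r))
        ≡⟨ width-*-pool i ⟨
      width i * pool i
        ≡⟨ flow-toℕ i ⟨
      flow a ∎
      where
      a r : ℕ
      a = toℕ i
      r = toℕ (opposite i)

  module _ {E K : ℕ} (ST : SquareTriangular E K) where
    open SquareTriangular ST
    open Counts ST using (L)

    -- This is 2L + 1 - (K + 1), an integer slightly above √2 L; a lower bound for it is an upper
    -- bound for K + 1.
    long-side : ℕ
    long-side = 2 * E + K + 2

    long-side-sum : suc K + long-side ≡ suc (L + L)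
    long-side-sum = solve 2 (λ E K → (con 1 :+ K) :+ (con 2 :* E :+ K :+ con 2)
      := con 1 :+ ((con 1 :+ (E :+ K)) :+ (con 1 :+ (E :+ K)))) refl E K

    -- By the Pell equation the square exceeds 2L² by exactly 4E + K + 2.
    long-side-bound : 2 * (L * L) ≤ long-side * long-side
    long-side-bound = +-cancelʳ-≤ (K * suc K) _ _ (subst (2 * (L * L) + K * suc K ≤_)
      (trans
        (cong (λ m → 2 * (L * L) + m + (4 * E + 2 + K)) (sym pell))
        (solve 2 (λ E K → con 2 :* ((con 1 :+ (E :+ K)) :* (con 1 :+ (E :+ K))) :+ con 2 :* (E :* E)
            :+ (con 4 :* E :+ con 2 :+ K)
          := (con 2 :* E :+ K :+ con 2) :* (con 2 :* E :+ K :+ con 2) :+ K :* (con 1 :+ K)) refl E K))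
      (m≤m+n _ (4 * E + 2 + K)))

open SquareTriangularNumbers

module _ (ℝ : RealField) where
  open RealField ℝ
  open FullyOnlineMatching ℝ
  open CommutativeRing commutativeRing
    using (+-assoc; +-comm; +-identityˡ; +-identityʳ; -‿inverseʳ;
           *-assoc; *-comm; *-identityˡ; *-identityʳ; distribʳ;
           zeroˡ; zeroʳ; semiring)
  open DecTotalOrder decTotalOrder using (_≟_)
    renaming (refl to ≤-refl; reflexive to ≤-reflexive; trans to ≤-trans;
              antisym to ≤-antisym; total to ≤-total)
  open SemiringSum semiring
    using (sum-cong-≗; sum-replicate; sum-replicate-zero; ∑-distrib-+; ∑-comm; ∑-permute; *-distribˡ-sum)
  open Max totalOrder using (x≤x⊔y; x≤y⊔x; ⊔-lub; x≤y⇒x⊔y≈y; x≤y⇒y⊔x≈y)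
  open Min totalOrder using (x⊓y≤x; x⊓y≤y; ⊓-glb; x≤y⇒x⊓y≈x; x≤y⇒y⊓x≈x)

  -- Ordered fields and finite sums

  -- The ring solver takes its coefficients from ℤ, where equality is decided by computation and
  -- like terms can cancel. With the optimised multiples the numerals 1 and 2 evaluate to `1#` and
  -- `2#`, so that solved equations match the goals definitionally.
  module IntegerCoefficients where
    open RingProperties (CommutativeRing.ring commutativeRing)
    open Mult semiring renaming (_×_ to _·′_)

    ⟦_⟧ : ℤ → Carrier
    ⟦ ℤ.+ n ⟧      = n ·′ 1#
    ⟦ -[1+ n ] ⟧ = - (suc n ·′ 1#)

    ⟦⟧-neg : ∀ i → ⟦ ℤ.- i ⟧ ≡ - ⟦ i ⟧
    ⟦⟧-neg (ℤ.+ zero)    = sym -0#≈0#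
    ⟦⟧-neg (ℤ.+ suc n)   = refl
    ⟦⟧-neg (-[1+ n ])  = sym (-‿involutive _)

    private
      +-cancel-middle : ∀ a b c → (a + b) - (a + c) ≡ b - c
      +-cancel-middle a b c = begin
        (a + b) + - (a + c)     ≡⟨ cong ((a + b) +_) (-‿anti-homo-+ a c) ⟩
        (a + b) + (- c + - a)   ≡⟨ cong (_+ (- c + - a)) (+-comm a b) ⟩
        (b + a) + (- c + - a)   ≡⟨ cong ((b + a) +_) (+-comm (- c) (- a)) ⟩
        (b + a) + (- a + - c)   ≡⟨ +-assoc b a _ ⟩
        b + (a + (- a + - c))   ≡⟨ cong (b +_) (sym (+-assoc a (- a) (- c))) ⟩
        b + ((a + - a) + - c)   ≡⟨ cong (λ z → b + (z + - c)) (-‿inverseʳ a) ⟩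
        b + (0# + - c)          ≡⟨ cong (b +_) (+-identityˡ _) ⟩
        b + - c                 ∎

    ⟦⟧-⊖ : ∀ m n → ⟦ m ⊖ n ⟧ ≡ m ·′ 1# - n ·′ 1#
    ⟦⟧-⊖ m zero = sym (trans (cong (m ·′ 1# +_) -0#≈0#) (+-identityʳ _))
    ⟦⟧-⊖ zero (suc n) = sym (+-identityˡ _)
    ⟦⟧-⊖ (suc m) (suc n) = begin
      ⟦ suc m ⊖ suc n ⟧                  ≡⟨ cong ⟦_⟧ (ℤ.[1+m]⊖[1+n]≡m⊖n m n) ⟩
      ⟦ m ⊖ n ⟧                          ≡⟨ ⟦⟧-⊖ m n ⟩
      m ·′ 1# - n ·′ 1#                  ≡⟨ +-cancel-middle 1# _ _ ⟨
      (1# + m ·′ 1#) - (1# + n ·′ 1#)    ≡⟨ cong₂ _-_ (1+× m 1#) (1+× n 1#) ⟨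
      suc m ·′ 1# - suc n ·′ 1#          ∎

    ⟦⟧-+ : ∀ i j → ⟦ i ℤ.+ j ⟧ ≡ ⟦ i ⟧ + ⟦ j ⟧
    ⟦⟧-+ (ℤ.+ m)      (ℤ.+ n)      = ×-homo-+ 1# m n
    ⟦⟧-+ (ℤ.+ m)      (-[1+ n ]) = ⟦⟧-⊖ m (suc n)
    ⟦⟧-+ (-[1+ m ]) (ℤ.+ n)      = trans (⟦⟧-⊖ n (suc m)) (+-comm _ _)
    ⟦⟧-+ (-[1+ m ]) (-[1+ n ]) = begin
      - (suc (suc (m ℕ.+ n)) ·′ 1#)      ≡⟨ cong (λ k → - (k ·′ 1#)) (cong suc (ℕ.+-suc m n)) ⟨
      - ((suc m ℕ.+ suc n) ·′ 1#)        ≡⟨ cong -_ (×-homo-+ 1# (suc m) (suc n)) ⟩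
      - (suc m ·′ 1# + suc n ·′ 1#)      ≡⟨ -‿anti-homo-+ _ _ ⟩
      - (suc n ·′ 1#) - suc m ·′ 1#      ≡⟨ +-comm _ _ ⟩
      - (suc m ·′ 1#) - suc n ·′ 1#      ∎

    ⟦⟧-* : ∀ i j → ⟦ i ℤ.* j ⟧ ≡ ⟦ i ⟧ * ⟦ j ⟧
    ⟦⟧-* (ℤ.+ m)      (ℤ.+ n)      = trans (cong ⟦_⟧ (sym (ℤ.pos-* m n))) (×1-homo-* m n)
    ⟦⟧-* (ℤ.+ m)      (-[1+ n ]) = begin
      ⟦ ℤ.+ m ℤ.* (ℤ.- ℤ.+ suc n) ⟧    ≡⟨ cong ⟦_⟧ (ℤ.neg-distribʳ-* (ℤ.+ m) (ℤ.+ suc n)) ⟨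
      ⟦ ℤ.- (ℤ.+ m ℤ.* ℤ.+ suc n) ⟧    ≡⟨ ⟦⟧-neg (ℤ.+ m ℤ.* ℤ.+ suc n) ⟩
      - ⟦ ℤ.+ m ℤ.* ℤ.+ suc n ⟧        ≡⟨ cong -_ (⟦⟧-* (ℤ.+ m) (ℤ.+ suc n)) ⟩
      - (⟦ ℤ.+ m ⟧ * ⟦ ℤ.+ suc n ⟧)    ≡⟨ -‿distribʳ-* _ _ ⟩
      ⟦ ℤ.+ m ⟧ * - ⟦ ℤ.+ suc n ⟧      ∎
    ⟦⟧-* (-[1+ m ]) (ℤ.+ n) = begin
      ⟦ (ℤ.- ℤ.+ suc m) ℤ.* ℤ.+ n ⟧    ≡⟨ cong ⟦_⟧ (ℤ.neg-distribˡ-* (ℤ.+ suc m) (ℤ.+ n)) ⟨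
      ⟦ ℤ.- (ℤ.+ suc m ℤ.* ℤ.+ n) ⟧    ≡⟨ ⟦⟧-neg (ℤ.+ suc m ℤ.* ℤ.+ n) ⟩
      - ⟦ ℤ.+ suc m ℤ.* ℤ.+ n ⟧        ≡⟨ cong -_ (⟦⟧-* (ℤ.+ suc m) (ℤ.+ n)) ⟩
      - (⟦ ℤ.+ suc m ⟧ * ⟦ ℤ.+ n ⟧)    ≡⟨ -‿distribˡ-* _ _ ⟩
      - ⟦ ℤ.+ suc m ⟧ * ⟦ ℤ.+ n ⟧      ∎
    ⟦⟧-* (-[1+ m ]) (-[1+ n ]) = begin
      (suc m ℕ.* suc n) ·′ 1#              ≡⟨ ×1-homo-* (suc m) (suc n) ⟩
      suc m ·′ 1# * suc n ·′ 1#            ≡⟨ -‿involutive _ ⟨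
      - (- (suc m ·′ 1# * suc n ·′ 1#))    ≡⟨ cong -_ (-‿distribˡ-* _ _) ⟩
      - (- (suc m ·′ 1#) * suc n ·′ 1#)    ≡⟨ -‿distribʳ-* _ _ ⟩
      - (suc m ·′ 1#) * - (suc n ·′ 1#)    ∎

    almostCommutativeRing : AlmostCommutativeRing _ _
    almostCommutativeRing = fromCommutativeRing commutativeRing

    morphism : ℤ.+-*-rawRing -Raw-AlmostCommutative⟶ almostCommutativeRing
    morphism = record
      { ⟦_⟧ = ⟦_⟧ ; +-homo = ⟦⟧-+ ; *-homo = ⟦⟧-* ; -‿homo = ⟦⟧-neg
      ; 0-homo = refl ; 1-homo = refl }

    weaklyDecide : ∀ i j → Maybe (⟦ i ⟧ ≡ ⟦ j ⟧)
    weaklyDecide i j with i ℤ.≟ j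
    ... | yes i≡j = just (cong ⟦_⟧ i≡j)
    ... | no  _   = nothing

    open RingSolver ℤ.+-*-rawRing almostCommutativeRing morphism weaklyDecide public
      using (solve; con; _:+_; _:*_; _:-_; :-_; _:=_; Polynomial)

  open IntegerCoefficients public using (solve; con; _:+_; _:*_; _:-_; :-_; _:=_; Polynomial)

  infix 10 #_
  #_ : ∀ {n} → ℕ → Polynomial n
  # k = con (ℤ.+ k)

  nonNeg-difference : ∀ {x y} → x ≤ y → 0# ≤ y - x
  nonNeg-difference {x} {y} x≤y =
    subst (_≤ y - x) (-‿inverseʳ x) (+-monoˡ-≤ (- x) x≤y)

  ≤-gap : ∀ {x y} d → 0# ≤ d → x + d ≡ y → x ≤ y
  ≤-gap {x} {y} d 0≤d x+d≡y =
    subst₂ _≤_ (+-identityˡ x) (trans (+-comm d x) x+d≡y) (+-monoˡ-≤ x 0≤d)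

  difference-nonNeg : ∀ {x y} → 0# ≤ y - x → x ≤ y
  difference-nonNeg {x} {y} 0≤y-x =
    ≤-gap (y - x) 0≤y-x (solve 2 (λ x y → x :+ (y :- x) := y) refl x y)

  +-mono-≤ : ∀ {w x y z} → w ≤ x → y ≤ z → w + y ≤ x + z
  +-mono-≤ {w} {x} {y} {z} w≤x y≤z =
    ≤-trans (+-monoˡ-≤ y w≤x) (subst₂ _≤_ (+-comm y x) (+-comm z x) (+-monoˡ-≤ x y≤z))

  +-nonNeg : ∀ {x y} → 0# ≤ x → 0# ≤ y → 0# ≤ x + y
  +-nonNeg 0≤x 0≤y = subst (_≤ _) (+-identityˡ 0#) (+-mono-≤ 0≤x 0≤y)

  x≤x+y : ∀ {x y} → 0# ≤ y → x ≤ x + y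
  x≤x+y {y = y} 0≤y = ≤-gap y 0≤y refl

  *-monoˡ-≤ : ∀ {c x y} → 0# ≤ c → x ≤ y → c * x ≤ c * y
  *-monoˡ-≤ {c} {x} {y} 0≤c x≤y =
    ≤-gap (c * (y - x)) (*-nonNeg 0≤c (nonNeg-difference x≤y))
      (solve 3 (λ c x y → c :* x :+ c :* (y :- x) := c :* y) refl c x y)

  *-monoʳ-≤ : ∀ {c x y} → 0# ≤ c → x ≤ y → x * c ≤ y * c
  *-monoʳ-≤ {c} {x} {y} 0≤c x≤y = subst₂ _≤_ (*-comm c x) (*-comm c y) (*-monoˡ-≤ 0≤c x≤y)

  square-nonNeg : ∀ x → 0# ≤ x * x
  square-nonNeg x with ≤-total 0# x
  ... | inj₁ 0≤x = *-nonNeg 0≤x 0≤x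
  ... | inj₂ x≤0 = subst (0# ≤_) (solve 1 (λ x → (# 0 :- x) :* (# 0 :- x) := x :* x) refl x)
                     (*-nonNeg (nonNeg-difference x≤0) (nonNeg-difference x≤0))

  0≤1 : 0# ≤ 1#
  0≤1 = subst (0# ≤_) (*-identityˡ 1#) (square-nonNeg 1#)

  1≢0 : 1# ≢ 0#
  1≢0 1≡0 = 0≢1 (sym 1≡0)

  *-cancelˡ-≡ : ∀ {c x y} → c ≢ 0# → c * x ≡ c * y → x ≡ y
  *-cancelˡ-≡ {c} {x} {y} c≢0 cx≡cy with inverse c c≢0
  ... | c⁻¹ , cc⁻¹≡1 = trans (sym (c⁻¹cz≡z x)) (trans (cong (c⁻¹ *_) cx≡cy) (c⁻¹cz≡z y))
    where
    c⁻¹cz≡z : ∀ z → c⁻¹ * (c * z) ≡ z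
    c⁻¹cz≡z z = begin
      c⁻¹ * (c * z)  ≡⟨ solve 3 (λ c d z → d :* (c :* z) := (c :* d) :* z) refl c c⁻¹ z ⟩
      c * c⁻¹ * z    ≡⟨ cong (_* z) cc⁻¹≡1 ⟩
      1# * z         ≡⟨ *-identityˡ z ⟩
      z              ∎

  *-cancelˡ-≤ : ∀ {c x y} → 0# < c → c * x ≤ c * y → x ≤ y
  *-cancelˡ-≤ {c} {x} {y} (0≤c , 0≢c) cx≤cy with ≤-total x y
  ... | inj₁ x≤y = x≤y
  ... | inj₂ y≤x = ≤-reflexive (*-cancelˡ-≡ (≢-sym 0≢c) (≤-antisym cx≤cy (*-monoˡ-≤ 0≤c y≤x)))

  <⇒≱ : ∀ {x y} → x < y → ¬ (y ≤ x)
  <⇒≱ (x≤y , x≢y) y≤x = x≢y (≤-antisym x≤y y≤x)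

  ≰⇒< : ∀ {x y} → ¬ (y ≤ x) → x < y
  ≰⇒< {x} {y} y≰x with ≤-total x y
  ... | inj₁ x≤y = x≤y , λ x≡y → y≰x (≤-reflexive (sym x≡y))
  ... | inj₂ y≤x with () ← y≰x y≤x

  <-≤-trans : ∀ {x y z} → x < y → y ≤ z → x < z
  <-≤-trans x<y y≤z = ≰⇒< λ z≤x → <⇒≱ x<y (≤-trans y≤z z≤x)

  0<1 : 0# < 1#
  0<1 = 0≤1 , 0≢1

  -- If y < x then y² ≤ xy ≤ x² ≤ y², so that y (x - y) = x (x - y) = 0.
  square-cancel-≤ : ∀ {x y} → 0# ≤ y → x * x ≤ y * y → x ≤ y
  square-cancel-≤ {x} {y} 0≤y x²≤y² with ≤-total x y
  ... | inj₁ x≤y = x≤y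
  ... | inj₂ y≤x = ≤-reflexive (x≡y (≤-antisym x²≤y² y²≤x²))
    where
    y²≤xy : y * y ≤ x * y
    y²≤xy = *-monoʳ-≤ 0≤y y≤x
    xy≤x² : x * y ≤ x * x
    xy≤x² = *-monoˡ-≤ (≤-trans 0≤y y≤x) y≤x
    y²≤x² : y * y ≤ x * x
    y²≤x² = ≤-trans y²≤xy xy≤x²
    x≡y : x * x ≡ y * y → x ≡ y
    x≡y x²≡y² with x ≟ 0#
    ... | yes x≡0 = ≤-antisym (subst (_≤ y) (sym x≡0) 0≤y) y≤x
    ... | no  x≢0 = *-cancelˡ-≡ x≢0
            (≤-antisym (subst (_≤ x * y) (sym x²≡y²) y²≤xy) xy≤x²)

  √2≤2 : √2 ≤ 2#
  √2≤2 = square-cancel-≤ (+-nonNeg 0≤1 0≤1) (subst (_≤ 2# * 2#) (sym √2*√2≡2)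
    (≤-gap 2# (+-nonNeg 0≤1 0≤1) (solve 0 (# 2 :+ # 2 := # 2 :* # 2) refl)))

  -- Definitionally the conditionals in value and ∑N.
  when : ∀ {p} {P : Set p} → Dec P → Carrier → Carrier
  when P? a = if does P? then a else 0#

  module _ {p} {P : Set p} where

    when-yes : ∀ (P? : Dec P) {a} → P → when P? a ≡ a
    when-yes (yes _)  _  = refl
    when-yes (no ¬Pa) Pa with () ← ¬Pa Pa

    when-no : ∀ (P? : Dec P) {a} → ¬ P → when P? a ≡ 0#
    when-no (yes Pa) ¬Pa with () ← ¬Pa Pa
    when-no (no _)   _   = refl

    when-cong : ∀ (P? : Dec P) {a b} → (P → a ≡ b) → when P? a ≡ when P? b
    when-cong (yes Pa) a≡b = a≡b Pa
    when-cong (no _)   _   = refl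

    when-mono-≤ : ∀ (P? : Dec P) {a b} → (P → a ≤ b) → when P? a ≤ when P? b
    when-mono-≤ (yes Pa) a≤b = a≤b Pa
    when-mono-≤ (no _)   _   = ≤-refl

    when-≤ : ∀ (P? : Dec P) {a} → 0# ≤ a → when P? a ≤ a
    when-≤ (yes _) _   = ≤-refl
    when-≤ (no _)  0≤a = 0≤a

    when-nonNeg : ∀ (P? : Dec P) {a} → (P → 0# ≤ a) → 0# ≤ when P? a
    when-nonNeg (yes Pa) 0≤a = 0≤a Pa
    when-nonNeg (no _)   _   = ≤-refl

    when-0 : ∀ (P? : Dec P) → when P? 0# ≡ 0#
    when-0 (yes _) = refl
    when-0 (no _)  = refl

    when-+ : ∀ (P? : Dec P) a b → when P? (a + b) ≡ when P? a + when P? b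
    when-+ (yes _) a b = refl
    when-+ (no _)  a b = sym (+-identityˡ 0#)

    when-*ˡ : ∀ (P? : Dec P) c a → when P? (c * a) ≡ c * when P? a
    when-*ˡ (yes _) c a = refl
    when-*ˡ (no _)  c a = sym (zeroʳ c)

  when-⇔ : ∀ {p q} {P : Set p} {Q : Set q} (P? : Dec P) (Q? : Dec Q) {a} →
           (P → Q) → (Q → P) → when P? a ≡ when Q? a
  when-⇔ (yes Pa) Q? P⇒Q Q⇒P = sym (when-yes Q? (P⇒Q Pa))
  when-⇔ (no ¬Pa) Q? P⇒Q Q⇒P = sym (when-no Q? (λ Qa → ¬Pa (Q⇒P Qa)))

  when-× : ∀ {p q} {P : Set p} {Q : Set q} (P? : Dec P) (Q? : Dec Q) {a} →
           when (P? ×-dec Q?) a ≡ when P? (when Q? a)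
  when-× (yes _) _ = refl
  when-× (no _)  _ = refl

  sum-0 : ∀ {n} {f : Fin n → Carrier} → (∀ i → f i ≡ 0#) → sum f ≡ 0#
  sum-0 {n} f≡0 = trans (sum-cong-≗ f≡0) (sum-replicate-zero n)

  sum-mono-≤ : ∀ {n} {f g : Fin n → Carrier} → (∀ i → f i ≤ g i) → sum f ≤ sum g
  sum-mono-≤ {zero}  f≤g = ≤-refl
  sum-mono-≤ {suc n} f≤g = +-mono-≤ (f≤g zero) (sum-mono-≤ (λ i → f≤g (suc i)))

  sum-nonNeg : ∀ {n} {f : Fin n → Carrier} → (∀ i → 0# ≤ f i) → 0# ≤ sum f
  sum-nonNeg {n} {f} 0≤f = subst (_≤ sum f) (sum-replicate-zero n) (sum-mono-≤ {n} 0≤f)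

  term≤sum : ∀ {n} {f : Fin n → Carrier} → (∀ i → 0# ≤ f i) → ∀ i → f i ≤ sum f
  term≤sum {suc n} 0≤f zero    = x≤x+y (sum-nonNeg {n} (λ i → 0≤f (suc i)))
  term≤sum {suc n} {f} 0≤f (suc i) = ≤-trans (term≤sum {n} (λ i → 0≤f (suc i)) i)
    (subst (_≤ sum f) (+-identityˡ _) (+-monoˡ-≤ _ (0≤f zero)))

  sum-* : ∀ {n} c (f : Fin n → Carrier) → ∑[ i < n ] (c * f i) ≡ c * sum f
  sum-* c f = sym (*-distribˡ-sum c f)

  sum-minus : ∀ {n} (f g : Fin n → Carrier) → ∑[ i < n ] (f i - g i) ≡ sum f - sum g
  sum-minus {n} f g = begin
    ∑[ i < n ] (f i - g i)
      ≡⟨ sum-cong-≗ (λ i → solve 2 (λ a b → a :- b := a :+ (:- # 1) :* b) refl (f i) (g i)) ⟩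
    ∑[ i < n ] (f i + - 1# * g i)
      ≡⟨ ∑-distrib-+ f (λ i → - 1# * g i) ⟩
    sum f + ∑[ i < n ] (- 1# * g i)
      ≡⟨ cong (sum f +_) (sum-* (- 1#) g) ⟩
    sum f + - 1# * sum g
      ≡⟨ solve 2 (λ a b → a :+ (:- # 1) :* b := a :- b) refl (sum f) (sum g) ⟩
    sum f - sum g ∎

  sum-≤-≡⇒≡ : ∀ {n} {f g : Fin n → Carrier} → (∀ i → f i ≤ g i) → sum f ≡ sum g →
              ∀ i → f i ≡ g i
  sum-≤-≡⇒≡ {n} {f} {g} f≤g Σf≡Σg i = ≤-antisym (f≤g i) (difference-nonNeg (0≤f-g i))
    where
    Σ≡0 : ∑[ i < n ] (g i - f i) ≡ 0#
    Σ≡0 = trans (sum-minus g f) (trans (cong (λ z → sum g - z) Σf≡Σg) (-‿inverseʳ (sum g)))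
    0≤f-g : ∀ i → 0# ≤ f i - g i
    0≤f-g i = subst (_≤ f i - g i) (-‿inverseʳ (f i)) (
      ≤-gap (0# - (g i - f i))
        (nonNeg-difference (subst (g i - f i ≤_) Σ≡0
          (term≤sum (λ i → nonNeg-difference (f≤g i)) i)))
        (solve 2 (λ a b → (a :- a) :+ (# 0 :- (b :- a)) := a :- b) refl (f i) (g i)))

  sum-point : ∀ {n} (f : Fin n → Carrier) u → ∑[ v < n ] when (v Fin.≟ u) (f v) ≡ f u
  sum-point {suc n} f zero = begin
    f zero + ∑[ v < n ] when (suc v Fin.≟ zero) (f (suc v))
      ≡⟨ cong (f zero +_) (sum-0 {n} (λ v → refl)) ⟩
    f zero + 0#  ≡⟨ +-identityʳ _ ⟩
    f zero       ∎
  sum-point {suc n} f (suc u) = begin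
    0# + ∑[ v < n ] when (suc v Fin.≟ suc u) (f (suc v))
      ≡⟨ +-identityˡ _ ⟩
    ∑[ v < n ] when (suc v Fin.≟ suc u) (f (suc v))
      ≡⟨ sum-cong-≗ (λ v → when-⇔ (suc v Fin.≟ suc u) (v Fin.≟ u) Fin.suc-injective (cong suc)) ⟩
    ∑[ v < n ] when (v Fin.≟ u) (f (suc v))
      ≡⟨ sum-point (λ v → f (suc v)) u ⟩
    f (suc u) ∎

  when-sum : ∀ {p n} {P : Set p} (P? : Dec P) (f : Fin n → Carrier) →
             ∑[ v < n ] when P? (f v) ≡ when P? (sum f)
  when-sum         (yes _) f = refl
  when-sum {n = n} (no _)  f = sum-replicate-zero n

  -- Existence of runs

  -- Each edge is counted from both ends, and the diagonal vanishes by irreflexivity. All later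
  -- arguments sum levels, which treat both ends alike, and pass to `value` only through this.
  value-double : ∀ {n} {G : SimpleGraph n} {x} → IsFractionalMatching G x →
                 sum (level x) ≡ value x + value x
  value-double {n} {G} {x} M = begin
    ∑[ u < n ] ∑[ v < n ] x u v
      ≡⟨ sum-cong-≗ (λ u → trans (sum-cong-≗ (split u)) (∑-distrib-+ (upper u) (lower u))) ⟩
    ∑[ u < n ] (sum (upper u) + sum (lower u))
      ≡⟨ ∑-distrib-+ (λ u → sum (upper u)) (λ u → sum (lower u)) ⟩
    value x + ∑[ u < n ] ∑[ v < n ] lower u v
      ≡⟨ cong (value x +_) (∑-comm lower) ⟩
    value x + ∑[ v < n ] ∑[ u < n ] lower u v
      ≡⟨ cong (value x +_) (sum-cong-≗ λ v → sum-cong-≗ λ u →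
           when-cong (v Fin.<? u) (λ _ → symmetric u v)) ⟩
    value x + value x ∎
    where
    open IsFractionalMatching M
    upper lower : Fin n → Fin n → Carrier
    upper u v = when (u Fin.<? v) (x u v)
    lower u v = when (v Fin.<? u) (x u v)
    split : ∀ u v → x u v ≡ upper u v + lower u v
    split u v with Fin.<-cmp u v
    ... | tri< u<v _ v≮u = sym (trans (cong₂ _+_ (when-yes (u Fin.<? v) u<v) (when-no (v Fin.<? u) v≮u)) (+-identityʳ _))
    ... | tri> u≮v _ v<u = sym (trans (cong₂ _+_ (when-no (u Fin.<? v) u≮v) (when-yes (v Fin.<? u) v<u)) (+-identityˡ _))
    ... | tri≈ u≮v u≡v v≮u = begin
      x u v   ≡⟨ support u v (SimpleGraph.~-irrefl G u≡v) ⟩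
      0#      ≡⟨ +-identityˡ 0# ⟨
      0# + 0# ≡⟨ cong₂ _+_ (when-no (u Fin.<? v) u≮v) (when-no (v Fin.<? u) v≮u) ⟨
      upper u v + lower u v ∎

  module Service (I : Instance) (i : Fin (Instance.n I ℕ.+ Instance.n I)) (u : Fin (Instance.n I)) where
    open Instance I

    N : Fin n → Set
    N = AvailableNeighbour i u

    N? : ∀ v → Dec (N v)
    N? = availableNeighbour? i u

    u∉N : ¬ N u
    u∉N (u~u , _) = ~-irrefl refl u~u

    -- The change of the matrix when each available neighbour w of u gets `δ w` on the edge to u. As
    -- u is not its own neighbour, at most one summand is nonzero; the additive form lets the sums
    -- of levels be computed.
    increment : (Fin n → Carrier) → EdgeValues n
    increment δ v w = when (v Fin.≟ u) (when (N? w) (δ w)) + when (w Fin.≟ u) (when (N? v) (δ v))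

    increment-out : ∀ δ {w} → N w → increment δ u w ≡ δ w
    increment-out δ {w} Nw = begin
      when (u Fin.≟ u) (when (N? w) (δ w)) + when (w Fin.≟ u) (when (N? u) (δ u))
        ≡⟨ cong₂ _+_ (trans (when-yes (u Fin.≟ u) refl) (when-yes (N? w) Nw))
                     (trans (when-cong (w Fin.≟ u) (λ _ → when-no (N? u) u∉N)) (when-0 (w Fin.≟ u))) ⟩
      δ w + 0#  ≡⟨ +-identityʳ _ ⟩
      δ w       ∎

    increment-sym : ∀ δ v w → increment δ v w ≡ increment δ w v
    increment-sym δ v w = +-comm _ _

    increment-none : ∀ δ v w → ¬ (v ≡ u × N w) → ¬ (w ≡ u × N v) → increment δ v w ≡ 0#
    increment-none δ v w ¬out ¬in = trans (cong₂ _+_ (nil v w ¬out) (nil w v ¬in)) (+-identityˡ 0#)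
      where
      nil : ∀ v w → ¬ (v ≡ u × N w) → when (v Fin.≟ u) (when (N? w) (δ w)) ≡ 0#
      nil v w ¬vw = trans (when-cong (v Fin.≟ u) (λ v≡u → when-no (N? w) (λ Nw → ¬vw (v≡u , Nw)))) (when-0 (v Fin.≟ u))

    increment-nonNeg : ∀ {δ} → (∀ v → 0# ≤ δ v) → ∀ v w → 0# ≤ increment δ v w
    increment-nonNeg 0≤δ v w = +-nonNeg
      (when-nonNeg (v Fin.≟ u) (λ _ → when-nonNeg (N? w) (λ _ → 0≤δ w)))
      (when-nonNeg (w Fin.≟ u) (λ _ → when-nonNeg (N? v) (λ _ → 0≤δ v)))

    level-increment : ∀ δ v → level (increment δ) v ≡ when (v Fin.≟ u) (∑N I i u δ) + when (N? v) (δ v)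
    level-increment δ v = begin
      ∑[ w < n ] increment δ v w
        ≡⟨ ∑-distrib-+ (λ w → when (v Fin.≟ u) (when (N? w) (δ w))) (λ w → when (w Fin.≟ u) (when (N? v) (δ v))) ⟩
      ∑[ w < n ] when (v Fin.≟ u) (when (N? w) (δ w)) + ∑[ w < n ] when (w Fin.≟ u) (when (N? v) (δ v))
        ≡⟨ cong₂ _+_ (when-sum (v Fin.≟ u) (λ w → when (N? w) (δ w))) (sum-point (λ _ → when (N? v) (δ v)) u) ⟩
      when (v Fin.≟ u) (∑N I i u δ) + when (N? v) (δ v) ∎

    module _ {x x′ : EdgeValues n} {δ : Fin n → Carrier} (step : ∀ v w → x′ v w ≡ x v w + increment δ v w) where

      level-step : ∀ v → level x′ v ≡ level x v + (when (v Fin.≟ u) (∑N I i u δ) + when (N? v) (δ v))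
      level-step v = begin
        level x′ v                         ≡⟨ sum-cong-≗ (step v) ⟩
        ∑[ w < n ] (x v w + increment δ v w) ≡⟨ ∑-distrib-+ (x v) (increment δ v) ⟩
        level x v + level (increment δ) v  ≡⟨ cong (level x v +_) (level-increment δ v) ⟩
        level x v + (when (v Fin.≟ u) (∑N I i u δ) + when (N? v) (δ v)) ∎

      level-step-u : level x′ u ≡ level x u + ∑N I i u δ
      level-step-u = trans (level-step u) (cong (level x u +_)
        (trans (cong₂ _+_ (when-yes (u Fin.≟ u) refl) (when-no (N? u) u∉N)) (+-identityʳ _)))

      level-step-≢ : ∀ {v} → v ≢ u → level x′ v ≡ level x v + when (N? v) (δ v)
      level-step-≢ {v} v≢u = trans (level-step v) (cong (level x v +_)
        (trans (cong (_+ when (N? v) (δ v)) (when-no (v Fin.≟ u) v≢u)) (+-identityˡ _)))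

      level-step-N : ∀ {v} → N v → level x′ v ≡ level x v + δ v
      level-step-N {v} Nv = trans (level-step-≢ (λ { refl → u∉N Nv })) (cong (level x v +_) (when-yes (N? v) Nv))

      level-step-none : ∀ {v} → v ≢ u → ¬ N v → level x′ v ≡ level x v
      level-step-none {v} v≢u v∉N = trans (level-step-≢ v≢u) (trans (cong (level x v +_) (when-no (N? v) v∉N)) (+-identityʳ _))

      sum-level-step : sum (level x′) ≡ sum (level x) + (∑N I i u δ + ∑N I i u δ)
      sum-level-step = begin
        sum (level x′) ≡⟨ sum-cong-≗ level-step ⟩
        ∑[ v < n ] (level x v + (when (v Fin.≟ u) (∑N I i u δ) + when (N? v) (δ v)))
          ≡⟨ ∑-distrib-+ (level x) (λ v → when (v Fin.≟ u) (∑N I i u δ) + when (N? v) (δ v)) ⟩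
        sum (level x) + ∑[ v < n ] (when (v Fin.≟ u) (∑N I i u δ) + when (N? v) (δ v))
          ≡⟨ cong (sum (level x) +_) (∑-distrib-+ (λ v → when (v Fin.≟ u) (∑N I i u δ)) (λ v → when (N? v) (δ v))) ⟩
        sum (level x) + (∑[ v < n ] when (v Fin.≟ u) (∑N I i u δ) + ∑N I i u δ)
          ≡⟨ cong (λ a → sum (level x) + (a + ∑N I i u δ)) (sum-point (λ _ → ∑N I i u δ) u) ⟩
        sum (level x) + (∑N I i u δ + ∑N I i u δ) ∎

    -- All that the later analyses use of `raised` and `unchanged`; beyond it they need only the
    -- total rise and, for the charging, the bound on the level.
    fills⇒increment : ∀ {x x′ ℓ} (F : FillsTo I i u x x′ ℓ) →
                      ∀ v w → x′ v w ≡ x v w + increment (FillsTo.rise F) v w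
    fills⇒increment {x} F v w with (v Fin.≟ u) ×-dec N? w | (w Fin.≟ u) ×-dec N? v
    ... | yes (refl , Nw) | _ = trans (proj₁ (raised w Nw)) (cong (x v w +_) (sym (increment-out rise Nw)))
      where open FillsTo F
    ... | no _ | yes (refl , Nv) = trans (proj₂ (raised v Nv)) (cong (x v w +_)
                                     (trans (sym (increment-out rise Nv)) (increment-sym rise w v)))
      where open FillsTo F
    ... | no ¬out | no ¬in = trans (unchanged v w ¬out ¬in)
           (trans (sym (+-identityʳ _)) (cong (x v w +_) (sym (increment-none rise v w ¬out ¬in))))
      where open FillsTo F

    position≡⇒available : ∀ {w} → i ≡ position (deadline u) → u ~ w → Available i u
    position≡⇒available refl u~w = ℕ.<⇒≤ (proj₁ (arrivalsFirst u~w)) , ℕ.≤-refl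

  -- The intermediate value property, kept as a predicate on f because without completeness it can
  -- fail for continuous functions. For the piecewise affine functions that occur, division
  -- suffices.
  Crosses : (Carrier → Carrier) → Carrier → Carrier → Set
  Crosses f lo hi = ∀ {T} → f lo ≤ T → T ≤ f hi → ∃[ z ] (lo ≤ z × z ≤ hi) × f z ≡ T

  crosses-affine : ∀ {c e lo hi} → 0# ≤ c → lo ≤ hi → Crosses (λ z → c * z + e) lo hi
  crosses-affine {c} {e} {lo} {hi} 0≤c lo≤hi {T} flo≤T T≤fhi with c ≟ 0#
  ... | yes refl = lo , (≤-refl , lo≤hi) , ≤-antisym flo≤T (subst (T ≤_) (flat hi lo) T≤fhi)
    where
    flat : ∀ y z → 0# * y + e ≡ 0# * z + e
    flat y z = cong (_+ e) (trans (zeroˡ y) (sym (zeroˡ z)))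
  ... | no c≢0 with inverse c c≢0
  ...   | c⁻¹ , cc⁻¹≡1 = z , (below , above) , fz≡T
    where
    z : Carrier
    z = c⁻¹ * (T - e)
    0<c : 0# < c
    0<c = 0≤c , ≢-sym c≢0
    cz≡T-e : c * z ≡ T - e
    cz≡T-e = trans (sym (*-assoc c c⁻¹ _)) (trans (cong (_* (T - e)) cc⁻¹≡1) (*-identityˡ _))
    shift : ∀ y → c * y + e - e ≡ c * y
    shift y = solve 3 (λ c y e → c :* y :+ e :- e := c :* y) refl c y e
    fz≡T : c * z + e ≡ T
    fz≡T = trans (cong (_+ e) cz≡T-e) (solve 2 (λ T e → T :- e :+ e := T) refl T e)
    below : lo ≤ z
    below = *-cancelˡ-≤ 0<c (subst₂ _≤_ (shift lo) (sym cz≡T-e) (+-monoˡ-≤ (- e) flo≤T))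
    above : z ≤ hi
    above = *-cancelˡ-≤ 0<c (subst₂ _≤_ (sym cz≡T-e) (shift hi) (+-monoˡ-≤ (- e) T≤fhi))

  crosses-cong : ∀ {f g lo hi} → lo ≤ hi → (∀ {z} → lo ≤ z → z ≤ hi → f z ≡ g z) →
                 Crosses g lo hi → Crosses f lo hi
  crosses-cong lo≤hi f≡g cross {T} flo≤T T≤fhi
    with cross (subst (_≤ T) (f≡g ≤-refl lo≤hi) flo≤T) (subst (T ≤_) (f≡g lo≤hi ≤-refl) T≤fhi)
  ... | z , (lo≤z , z≤hi) , gz≡T = z , (lo≤z , z≤hi) , trans (f≡g lo≤z z≤hi) gz≡T

  crosses-split : ∀ {f lo mid hi} → lo ≤ mid → mid ≤ hi →
                  Crosses f lo mid → Crosses f mid hi → Crosses f lo hi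
  crosses-split {f} {mid = mid} lo≤mid mid≤hi left right {T} flo≤T T≤fhi with ≤-total T (f mid)
  ... | inj₁ T≤fmid with left flo≤T T≤fmid
  ...   | z , (lo≤z , z≤mid) , fz≡T = z , (lo≤z , ≤-trans z≤mid mid≤hi) , fz≡T
  crosses-split lo≤mid mid≤hi left right flo≤T T≤fhi
      | inj₂ fmid≤T with right fmid≤T T≤fhi
  ...   | z , (mid≤z , z≤hi) , fz≡T = z , (≤-trans lo≤mid mid≤z , z≤hi) , fz≡T

  -- The affine part absorbs the hinges one at a time: below its corner y a
  -- hinge is 0, above it is z - y.
  crosses-hinges : ∀ {n} {N : Fin n → Set} (N? : ∀ v → Dec (N v)) (y : Fin n → Carrier)
                   {c e lo hi} → 0# ≤ c → lo ≤ hi →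
                   Crosses (λ z → c * z + e + ∑[ v < n ] when (N? v) ((y v ⊔ z) - y v)) lo hi
  crosses-hinges {zero} N? y 0≤c lo≤hi =
    crosses-cong lo≤hi (λ _ _ → +-identityʳ _) (crosses-affine 0≤c lo≤hi)
  crosses-hinges {suc n} N? y {c} {e} {lo} {hi} 0≤c lo≤hi with N? zero
  ... | no _ = crosses-cong lo≤hi (λ {z} _ _ → cong (c * z + e +_) (+-identityˡ _))
                 (crosses-hinges (λ v → N? (suc v)) (λ v → y (suc v)) 0≤c lo≤hi)
  ... | yes _ = by-cases (≤-total y₀ lo) (≤-total hi y₀)
    where
    y₀ : Carrier
    y₀ = y zero
    S : Carrier → Carrier
    S z = ∑[ v < n ] when (N? (suc v)) ((y (suc v) ⊔ z) - y (suc v))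
    f : Carrier → Carrier
    f z = c * z + e + ((y₀ ⊔ z) - y₀ + S z)
    flat : ∀ {lo hi} → lo ≤ hi → hi ≤ y₀ → Crosses f lo hi
    flat lo≤hi hi≤y = crosses-cong lo≤hi
      (λ {z} _ z≤hi → trans
        (cong (λ a → c * z + e + (a - y₀ + S z)) (x≤y⇒y⊔x≈y (≤-trans z≤hi hi≤y)))
        (solve 5 (λ c z e y s → c :* z :+ e :+ (y :- y :+ s) := c :* z :+ e :+ s) refl c z e y₀ (S z)))
      (crosses-hinges (λ v → N? (suc v)) (λ v → y (suc v)) 0≤c lo≤hi)
    steep : ∀ {lo hi} → lo ≤ hi → y₀ ≤ lo → Crosses f lo hi
    steep lo≤hi y≤lo = crosses-cong lo≤hi
      (λ {z} lo≤z _ → trans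
        (cong (λ a → c * z + e + (a - y₀ + S z)) (x≤y⇒x⊔y≈y (≤-trans y≤lo lo≤z)))
        (solve 5 (λ c z e y s → c :* z :+ e :+ (z :- y :+ s) := (c :+ # 1) :* z :+ (e :- y) :+ s) refl c z e y₀ (S z)))
      (crosses-hinges (λ v → N? (suc v)) (λ v → y (suc v)) (+-nonNeg 0≤c 0≤1) lo≤hi)
    by-cases : y₀ ≤ lo ⊎ lo ≤ y₀ → hi ≤ y₀ ⊎ y₀ ≤ hi → Crosses f lo hi
    by-cases (inj₁ y≤lo) _           = steep lo≤hi y≤lo
    by-cases (inj₂ lo≤y) (inj₁ hi≤y) = flat lo≤hi hi≤y
    by-cases (inj₂ lo≤y) (inj₂ y≤hi) = crosses-split lo≤y y≤hi (flat lo≤y ≤-refl) (steep y≤hi ≤-refl)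

  chain : ∀ {S : Set} {m} {R : Fin m → S → S → Set} → (∀ i s → ∃[ s′ ] R i s s′) → S → Fin (suc m) → S
  chain {m = zero}  next s _       = s
  chain {m = suc m} next s zero    = s
  chain {m = suc m} next s (suc t) = chain (λ i → next (suc i)) (proj₁ (next zero s)) t

  chain-zero : ∀ {S : Set} {m} {R : Fin m → S → S → Set} (next : ∀ i s → ∃[ s′ ] R i s s′) s →
               chain next s zero ≡ s
  chain-zero {m = zero}  next s = refl
  chain-zero {m = suc m} next s = refl

  chain-step : ∀ {S : Set} {m} {R : Fin m → S → S → Set} (next : ∀ i s → ∃[ s′ ] R i s s′) s →
               ∀ i → R i (chain next s (inject₁ i)) (chain next s (suc i))
  chain-step {m = suc m} {R} next s zero =
    subst (R zero s) (sym (chain-zero (λ i → next (suc i)) _)) (proj₂ (next zero s))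
  chain-step {m = suc m} next s (suc i) = chain-step (λ i → next (suc i)) (proj₁ (next zero s)) i

  module Existence (I : Instance) where
    open Instance I

    State : Set
    State = ∃[ x ] IsFractionalMatching graph x

    record Next (i : Fin (n ℕ.+ n)) (s s′ : State) : Set where
      field
        waterFills    : WaterFillingStep I i (event i) (proj₁ s) (proj₁ s′)
        increases     : ∀ u v → proj₁ s u v ≤ proj₁ s′ u v
        staysInReach  : ∀ u v → proj₁ s u v ≢ proj₁ s′ u v → Available i u × Available i v

    module Fill (i : Fin (n ℕ.+ n)) (u : Fin n) (i≡ : i ≡ position (deadline u))
                (x : EdgeValues n) (M : IsFractionalMatching graph x) where
      open Service I i u
      open IsFractionalMatching M

      T : Carrier
      T = (1# - level x u) ⊓ ∑N I i u (λ v → 1# - level x v)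

      level-nonNeg : ∀ v → 0# ≤ level x v
      level-nonNeg v = sum-nonNeg (nonNeg v)

      filled : Carrier → Carrier
      filled z = ∑N I i u (λ v → (level x v ⊔ z) - level x v)

      filled-0 : filled 0# ≡ 0#
      filled-0 = sum-0 λ v → trans
        (when-cong (N? v) (λ _ → trans (cong (λ a → a - level x v) (x≤y⇒y⊔x≈y (level-nonNeg v))) (-‿inverseʳ _)))
        (when-0 (N? v))

      filled-1 : filled 1# ≡ ∑N I i u (λ v → 1# - level x v)
      filled-1 = sum-cong-≗ λ v → when-cong (N? v) (λ _ → cong (λ a → a - level x v) (x≤y⇒x⊔y≈y (level≤1 v)))

      0≤T : 0# ≤ T
      0≤T = ⊓-glb (nonNeg-difference (level≤1 u))
        (sum-nonNeg λ v → when-nonNeg (N? v) λ _ → nonNeg-difference (level≤1 v))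

      abstract
        crossing : ∃[ ℓ ] (0# ≤ ℓ × ℓ ≤ 1#) × 0# * ℓ + 0# + filled ℓ ≡ T
        -- The affine part starts as 0. The hinges alone make up `filled`, which grows from 0 at
        -- level 0 to the whole free capacity of the neighbours at level 1.
        crossing = crosses-hinges N? (level x) ≤-refl 0≤1
          (subst (_≤ T) (sym (trans (drop 0#) filled-0)) 0≤T)
          (subst (T ≤_) (sym (trans (drop 1#) filled-1)) (x⊓y≤y _ _))
          where
          drop : ∀ z → 0# * z + 0# + filled z ≡ filled z
          drop z = solve 2 (λ z s → # 0 :* z :+ # 0 :+ s := s) refl z (filled z)

      ℓ : Carrier
      ℓ = proj₁ crossing

      ℓ≤1 : ℓ ≤ 1#
      ℓ≤1 = proj₂ (proj₁ (proj₂ crossing))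

      rise : Fin n → Carrier
      rise v = (level x v ⊔ ℓ) - level x v

      total : ∑N I i u rise ≡ T
      total = trans (solve 2 (λ z s → s := # 0 :* z :+ # 0 :+ s) refl ℓ (filled ℓ)) (proj₂ (proj₂ crossing))

      x′ : EdgeValues n
      x′ v w = x v w + increment rise v w

      0≤rise : ∀ v → 0# ≤ rise v
      0≤rise v = nonNeg-difference (x≤x⊔y _ _)

      fillsTo : FillsTo I i u x x′ ℓ
      fillsTo = record
        { ℓ≤1 = ℓ≤1
        ; raised = λ v Nv → cong (x u v +_) (increment-out rise Nv)
                          , cong (x v u +_) (trans (increment-sym rise v u) (increment-out rise Nv))
        ; unchanged = λ v w ¬out ¬in → trans (cong (x v w +_) (increment-none rise v w ¬out ¬in)) (+-identityʳ _)
        ; total = total }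

      level′≤1 : ∀ v → level x′ v ≤ 1#
      level′≤1 v = by-cases (v Fin.≟ u) (N? v)
        where
        by-cases : Dec (v ≡ u) → Dec (N v) → level x′ v ≤ 1#
        by-cases (yes refl) _ = subst (_≤ 1#) (sym (level-step-u {x} {x′} {rise} (λ _ _ → refl)))
          (≤-gap (1# - level x u - T)
            (nonNeg-difference (x⊓y≤x _ _))
            (trans (cong (λ a → level x u + a + (1# - level x u - T)) total)
              (solve 2 (λ p t → p :+ t :+ (# 1 :- p :- t) := # 1) refl (level x u) T)))
        by-cases (no _) (yes Nv) = subst (_≤ 1#)
          (sym (trans (level-step-N {x} {x′} {rise} (λ _ _ → refl) Nv)
                 (solve 2 (λ y m → y :+ (m :- y) := m) refl (level x v) (level x v ⊔ ℓ))))
          (⊔-lub (level≤1 v) ℓ≤1)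
        by-cases (no v≢u) (no v∉N) =
          subst (_≤ 1#) (sym (level-step-none {x} {x′} {rise} (λ _ _ → refl) v≢u v∉N)) (level≤1 v)

      matching : IsFractionalMatching graph x′
      matching = record
        { symmetric = λ v w → cong₂ _+_ (symmetric v w) (increment-sym rise v w)
        ; support = λ v w v≁w → trans (cong₂ _+_ (support v w v≁w)
            (increment-none rise v w (λ { (refl , Nw) → v≁w (proj₁ Nw) }) (λ { (refl , Nv) → v≁w (~-sym (proj₁ Nv)) })))
            (+-identityʳ 0#)
        ; nonNeg = λ v w → +-nonNeg (nonNeg v w) (increment-nonNeg 0≤rise v w)
        ; level≤1 = level′≤1 }

      reach : ∀ v w → x v w ≢ x′ v w → Available i v × Available i w
      reach v w x≢x′ with (v Fin.≟ u) ×-dec N? w | (w Fin.≟ u) ×-dec N? v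
      ... | yes (refl , Nw) | _ = position≡⇒available i≡ (proj₁ Nw) , proj₂ Nw
      ... | no _ | yes (refl , Nv) = proj₂ Nv , position≡⇒available i≡ (proj₁ Nv)
      ... | no ¬out | no ¬in =
        contradiction (sym (trans (cong (x v w +_) (increment-none rise v w ¬out ¬in)) (+-identityʳ _))) x≢x′

    next : ∀ i s → ∃[ s′ ] Next i s s′
    next i (x , M) = serve (event i) refl
      where
      serve : ∀ e → event i ≡ e → ∃[ s′ ] Next i (x , M) s′
      serve (arrival v) eq = (x , M) , record
        { waterFills = subst (λ e → WaterFillingStep I i e x x) (sym eq) (λ _ _ → refl)
        ; increases = λ _ _ → ≤-refl
        ; staysInReach = λ _ _ x≢x → contradiction refl x≢x }
      serve (deadline u) eq = (x′ , matching) , record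
        { waterFills = subst (λ e → WaterFillingStep I i e x x′) (sym eq) (ℓ , fillsTo)
        ; increases = λ v w → x≤x+y (Service.increment-nonNeg I i u 0≤rise v w)
        ; staysInReach = reach }
        where open Fill i u (sym (Inverse.inverseʳ schedule (sym eq))) x M

    start : State
    start = (λ _ _ → 0#) , record
      { symmetric = λ _ _ → refl ; support = λ _ _ _ → refl ; nonNeg = λ _ _ → ≤-refl
      ; level≤1 = λ _ → subst (_≤ 1#) (sym (sum-replicate-zero n)) 0≤1 }

    states : Fin (suc (n ℕ.+ n)) → State
    states = chain next start

    run : Run I
    run = record
      { x = λ t → proj₁ (states t)
      ; initial = λ u v → cong (λ s → proj₁ s u v) (chain-zero next start)
      ; feasible = λ t → proj₂ (states t)
      ; increasing = λ i → Next.increases (chain-step next start i)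
      ; onlyAvailable = λ i → Next.staysInReach (chain-step next start i) }

  -- `Competitive` speaks about all runs of an algorithm. Existence keeps the ratio from holding
  -- vacuously and provides the run that refutes a larger one.
  waterFilling-exists : ∀ I → ∃[ ρ ] WaterFilling {I} ρ
  waterFilling-exists I = run , λ i → Next.waterFills (chain-step next start i)
    where open Existence I

  -- The competitive ratio

  4# Γ₀ target : Carrier
  4# = 2# * 2#
  Γ₀ = 2# - √2
  target = 4# * Γ₀

  0≤2 : 0# ≤ 2#
  0≤2 = +-nonNeg 0≤1 0≤1

  0≤Γ₀ : 0# ≤ Γ₀
  0≤Γ₀ = nonNeg-difference √2≤2

  -- 4 ∫ φ from 0 to y, for φ(y) = 1 − 1/√2 + y/√2; the factor 4 clears the
  -- denominators.
  share : Carrier → Carrier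
  share y = 2# * Γ₀ * y + √2 * (y * y)

  share-mono-≤ : ∀ {y z} → 0# ≤ y → y ≤ z → share y ≤ share z
  share-mono-≤ {y} {z} 0≤y y≤z = ≤-gap ((z - y) * (2# * Γ₀ + √2 * (y + z)))
    (*-nonNeg (nonNeg-difference y≤z)
      (+-nonNeg (*-nonNeg 0≤2 0≤Γ₀) (*-nonNeg 0≤√2 (+-nonNeg 0≤y (≤-trans 0≤y y≤z)))))
    (solve 4 (λ c s y z → c :* y :+ s :* (y :* y) :+ (z :- y) :* (c :+ s :* (y :+ z)) := c :* z :+ s :* (z :* z))
       refl (2# * Γ₀) √2 y z)

  -- The part kept by the vertex with the deadline when a neighbour rises from
  -- y to z.
  remainder : Carrier → Carrier → Carrier
  remainder y z = 4# * (z - y) - (share z - share y)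

  -- `remainder` is 4 times an integral of 1 - φ, and 4 (1 - φ(t)) = 2√2 (1 - t) is at least 2√2 (1
  -- - m) for t ≤ ℓ ≤ m. As m is free, the final level of one neighbour can serve in the bound for
  -- all of them.
  remainder-bound : ∀ {y ℓ m} → ℓ ≤ m → 2# * √2 * (1# - m) * ((y ⊔ ℓ) - y) ≤ remainder y (y ⊔ ℓ)
  remainder-bound {y} {ℓ} {m} ℓ≤m with ≤-total y ℓ
  ... | inj₁ y≤ℓ rewrite x≤y⇒x⊔y≈y y≤ℓ = ≤-gap (√2 * ((ℓ - y) * ((m - y) + (m - ℓ))))
    (*-nonNeg 0≤√2 (*-nonNeg (nonNeg-difference y≤ℓ)
      (+-nonNeg (nonNeg-difference (≤-trans y≤ℓ ℓ≤m)) (nonNeg-difference ℓ≤m))))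
    (solve 4 (λ s y ℓ m →
        # 2 :* s :* (# 1 :- m) :* (ℓ :- y) :+ s :* ((ℓ :- y) :* ((m :- y) :+ (m :- ℓ)))
        := # 2 :* # 2 :* (ℓ :- y) :- ((# 2 :* (# 2 :- s) :* ℓ :+ s :* (ℓ :* ℓ)) :- (# 2 :* (# 2 :- s) :* y :+ s :* (y :* y))))
      refl √2 y ℓ m)
  ... | inj₂ ℓ≤y rewrite x≤y⇒y⊔x≈y ℓ≤y = ≤-reflexive
    (solve 3 (λ c b z → c :* (z :- z) := # 2 :* # 2 :* (z :- z) :- (b :- b)) refl (2# * √2 * (1# - m)) (share y) y)

  remainder-nonNeg : ∀ {y ℓ} → ℓ ≤ 1# → 0# ≤ remainder y (y ⊔ ℓ)
  remainder-nonNeg {y} {ℓ} ℓ≤1 = subst (_≤ remainder y (y ⊔ ℓ))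
    (solve 2 (λ c d → c :* (# 1 :- # 1) :* d := # 0) refl (2# * √2) ((y ⊔ ℓ) - y)) (remainder-bound ℓ≤1)

  -- The difference of the two sides is √2 (p + m − (2 − √2))².
  edge-bound : ∀ p m → target ≤ share p + 2# * √2 * (1# - m) * (1# - p) + share m
  edge-bound p m = ≤-gap (√2 * (d * d)) (*-nonNeg 0≤√2 (square-nonNeg d)) (begin
    target + √2 * (d * d)
      ≡⟨ solve 2 (λ t k → t := t :+ # 0 :* k) refl _ k ⟩
    target + √2 * (d * d) + 0# * k
      ≡⟨ cong (λ z → target + √2 * (d * d) + z * k) (trans (cong (λ z → 2# - z) √2*√2≡2) (-‿inverseʳ 2#)) ⟨
    target + √2 * (d * d) + (2# - √2 * √2) * k
      ≡⟨ solve 3 (λ s p m →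
           # 2 :* # 2 :* (# 2 :- s) :+ s :* ((p :+ m :- (# 2 :- s)) :* (p :+ m :- (# 2 :- s)))
             :+ (# 2 :- s :* s) :* (# 2 :* (p :+ m) :+ s :- # 2 :* # 2)
           := (# 2 :* (# 2 :- s) :* p :+ s :* (p :* p)) :+ # 2 :* s :* (# 1 :- m) :* (# 1 :- p)
             :+ (# 2 :* (# 2 :- s) :* m :+ s :* (m :* m))) refl √2 p m ⟩
    share p + 2# * √2 * (1# - m) * (1# - p) + share m ∎)
    where
    d k : Carrier
    d = p + m - Γ₀
    -- The ring solver does not know that √2² = 2, so the multiple of 2 - √2² by which the two sides
    -- differ as polynomials is supplied by hand.
    k = 2# * (p + m) + √2 - 4#

  module Charging (I : Instance) where
    open Instance I

    -- Dual variables that certify the ratio for the edges with a passed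
    -- deadline; a vertex that still waits for its deadline has only been
    -- matched passively and owns exactly its shares.
    record Charges (t : ℕ) (x : EdgeValues n) : Set where
      field
        A       : Fin n → Carrier
        nonNeg  : ∀ v → 0# ≤ A v
        -- A unit of value is charged 4 and occurs in two levels, hence the factor 2.
        total   : sum A ≡ 2# * sum (level x)
        pending : ∀ v → t ℕ.≤ toℕ (position (deadline v)) → A v ≡ share (level x v)
        covers  : ∀ {v w} → v ~ w → toℕ (position (deadline v)) ℕ.< t → target ≤ A v + A w

    charges-initially : ∀ {x} → (∀ u v → x u v ≡ 0#) → Charges 0 x
    charges-initially {x} x≡0 = record
      { A = λ _ → 0#
      ; nonNeg = λ _ → ≤-refl
      ; total = trans (sum-replicate-zero n) (sym (trans (cong (2# *_) (sum-0 empty)) (zeroʳ 2#)))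
      ; pending = λ v _ → sym (trans (cong share (empty v))
          (solve 2 (λ c s → c :* # 0 :+ s :* (# 0 :* # 0) := # 0) refl (2# * Γ₀) √2))
      ; covers = λ _ () }
      where
      empty : ∀ v → level x v ≡ 0#
      empty v = sum-0 (x≡0 v)

    charges-arrival : ∀ {i v x x′} → event i ≡ arrival v → (∀ a b → x′ a b ≡ x a b) →
                      Charges (toℕ i) x → Charges (suc (toℕ i)) x′
    charges-arrival {i} {v} {x} {x′} eq same C = record
      { A = A
      ; nonNeg = nonNeg
      ; total = trans total (cong (2# *_) (sum-cong-≗ λ w → sym (level≡ w)))
      ; pending = λ w i<w → trans (pending w (ℕ.<⇒≤ i<w)) (cong share (sym (level≡ w)))
      ; covers = λ {w} w~z w≤i → covers w~z (ℕ.≤∧≢⇒< (ℕ.s≤s⁻¹ w≤i) (not-now w)) }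
      where
      open Charges C
      level≡ : ∀ w → level x′ w ≡ level x w
      level≡ w = sum-cong-≗ (same w)
      not-now : ∀ w → toℕ (position (deadline w)) ≢ toℕ i
      not-now w pos≡i with trans (sym eq) (Inverse.inverseˡ schedule (sym (Fin.toℕ-injective pos≡i)))
      ... | ()

    module Deadline {i u x x′ ℓ} (i≡ : i ≡ position (deadline u)) (M : IsFractionalMatching graph x)
                    (F : FillsTo I i u x x′ ℓ) (C : Charges (toℕ i) x) where
      open Service I i u
      open FillsTo F using (ℓ≤1; rise) renaming (total to risen)
      open Charges C

      step : ∀ v w → x′ v w ≡ x v w + increment rise v w
      step = fills⇒increment F

      p : Carrier
      p = level x u

      y y′ rest : Fin n → Carrier
      y    = level x
      y′ v = y v ⊔ ℓ
      rest v = remainder (y v) (y′ v)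

      0≤y : ∀ v → 0# ≤ y v
      0≤y v = sum-nonNeg (IsFractionalMatching.nonNeg M v)

      gain A′ : Fin n → Carrier
      gain v = when (v Fin.≟ u) (∑N I i u rest) + when (N? v) (share (y′ v) - share (y v))
      A′ v = A v + gain v

      0≤rest : ∀ v → 0# ≤ rest v
      0≤rest v = remainder-nonNeg ℓ≤1

      0≤gain : ∀ v → 0# ≤ gain v
      0≤gain v = +-nonNeg
        (when-nonNeg (v Fin.≟ u) λ _ → sum-nonNeg λ w → when-nonNeg (N? w) λ _ → 0≤rest w)
        (when-nonNeg (N? v) λ _ → nonNeg-difference (share-mono-≤ (0≤y v) (x≤x⊔y _ _)))

      A≤A′ : ∀ v → A v ≤ A′ v
      A≤A′ v = x≤x+y (0≤gain v)

      level-N : ∀ {v} → N v → level x′ v ≡ y′ v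
      level-N {v} Nv = trans (level-step-N {x} {x′} {rise} step Nv)
        (solve 2 (λ a b → a :+ (b :- a) := b) refl (y v) (y′ v))

      A′-N : ∀ {v} → N v → A v ≡ share (y v) → A′ v ≡ share (y′ v)
      A′-N {v} Nv Av≡ = begin
        A v + gain v
          ≡⟨ cong₂ _+_ Av≡ (cong₂ _+_ (when-no (v Fin.≟ u) (λ { refl → u∉N Nv })) (when-yes (N? v) Nv)) ⟩
        share (y v) + (0# + (share (y′ v) - share (y v)))
          ≡⟨ solve 2 (λ a b → a :+ (# 0 :+ (b :- a)) := b) refl (share (y v)) (share (y′ v)) ⟩
        share (y′ v) ∎

      A′-u : A′ u ≡ share p + ∑N I i u rest
      A′-u = cong₂ _+_ (pending u (ℕ.≤-reflexive (cong toℕ i≡)))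
        (trans (cong₂ _+_ (when-yes (u Fin.≟ u) refl) (when-no (N? u) u∉N)) (+-identityʳ _))

      total′ : sum A′ ≡ 2# * sum (level x′)
      total′ = begin
        sum A′  ≡⟨ ∑-distrib-+ A gain ⟩
        sum A + sum gain
          ≡⟨ cong (sum A +_) (∑-distrib-+ (λ v → when (v Fin.≟ u) (∑N I i u rest)) (λ v → when (N? v) (share (y′ v) - share (y v)))) ⟩
        sum A + (∑[ v < n ] when (v Fin.≟ u) (∑N I i u rest) + ∑N I i u (λ v → share (y′ v) - share (y v)))
          ≡⟨ cong (λ a → sum A + (a + ∑N I i u (λ v → share (y′ v) - share (y v)))) (sum-point (λ _ → ∑N I i u rest) u) ⟩
        sum A + (∑N I i u rest + ∑N I i u (λ v → share (y′ v) - share (y v)))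
          ≡⟨ cong (sum A +_) (∑-distrib-+ (λ v → when (N? v) (rest v)) (λ v → when (N? v) (share (y′ v) - share (y v)))) ⟨
        sum A + ∑[ v < n ] (when (N? v) (rest v) + when (N? v) (share (y′ v) - share (y v)))
          ≡⟨ cong (sum A +_) (sum-cong-≗ λ v → trans (sym (when-+ (N? v) (rest v) (share (y′ v) - share (y v))))
               (trans (when-cong (N? v) λ _ → solve 2 (λ a b → a :- b :+ b := a) refl (4# * rise v) (share (y′ v) - share (y v)))
                 (when-*ˡ (N? v) 4# (rise v)))) ⟩
        sum A + ∑[ v < n ] (4# * when (N? v) (rise v))
          ≡⟨ cong₂ _+_ total (sum-* 4# (λ v → when (N? v) (rise v))) ⟩
        2# * sum (level x) + 4# * ∑N I i u rise
          ≡⟨ solve 2 (λ a r → # 2 :* a :+ # 2 :* # 2 :* r := # 2 :* (a :+ (r :+ r))) refl (sum (level x)) (∑N I i u rise) ⟩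
        2# * (sum (level x) + (∑N I i u rise + ∑N I i u rise))
          ≡⟨ cong (2# *_) (sum-level-step {x} {x′} {rise} step) ⟨
        2# * sum (level x′) ∎

      pending′ : ∀ v → suc (toℕ i) ℕ.≤ toℕ (position (deadline v)) → A′ v ≡ share (level x′ v)
      pending′ v i<v = by-cases (N? v)
        where
        v≢u : v ≢ u
        v≢u refl = ℕ.<-irrefl (cong toℕ i≡) i<v
        Av≡ : A v ≡ share (y v)
        Av≡ = pending v (ℕ.<⇒≤ i<v)
        by-cases : Dec (N v) → A′ v ≡ share (level x′ v)
        by-cases (yes Nv) = trans (A′-N Nv Av≡) (cong share (sym (level-N Nv)))
        by-cases (no v∉N) = begin
          A v + gain v  ≡⟨ cong (A v +_) (cong₂ _+_ (when-no (v Fin.≟ u) v≢u) (when-no (N? v) v∉N)) ⟩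
          A v + (0# + 0#) ≡⟨ solve 1 (λ a → a :+ (# 0 :+ # 0) := a) refl (A v) ⟩
          A v           ≡⟨ Av≡ ⟩
          share (y v)   ≡⟨ cong share (level-step-none {x} {x′} {rise} step v≢u v∉N) ⟨
          share (level x′ v) ∎

      -- Water-filling stops when u is full or all its neighbours are.
      full-or-full : ∀ {w} → N w → (1# - y′ w) * ∑N I i u rise ≡ (1# - y′ w) * (1# - p)
      full-or-full {w} Nw with ≤-total (1# - p) (∑N I i u (λ v → 1# - y v))
      ... | inj₁ p-full = cong ((1# - y′ w) *_) (trans risen (x≤y⇒x⊓y≈x p-full))
      ... | inj₂ N-full = trans (vanish _) (sym (vanish _))
        where
        below : ∀ v → when (N? v) (rise v) ≤ when (N? v) (1# - y v)
        below v = when-mono-≤ (N? v) λ _ → +-monoˡ-≤ (- y v) (⊔-lub (IsFractionalMatching.level≤1 M v) ℓ≤1)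
        rise≡ : rise w ≡ 1# - y w
        rise≡ = trans (sym (when-yes (N? w) Nw))
          (trans (sum-≤-≡⇒≡ below (trans risen (x≤y⇒y⊓x≈x N-full)) w) (when-yes (N? w) Nw))
        vanish : ∀ a → (1# - y′ w) * a ≡ 0#
        vanish a = begin
          (1# - y′ w) * a       ≡⟨ solve 3 (λ b c a → (# 1 :- b) :* a := ((# 1 :- c) :- (b :- c)) :* a) refl (y′ w) (y w) a ⟩
          (1# - y w - rise w) * a ≡⟨ cong (λ r → (1# - y w - r) * a) rise≡ ⟩
          (1# - y w - (1# - y w)) * a ≡⟨ solve 2 (λ c a → (c :- c) :* a := # 0) refl (1# - y w) a ⟩
          0# ∎

      -- Here m in `edge-bound` is the level of w after the step. Since m ≥ ℓ, each unit of rise at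
      -- any neighbour leaves u at least 2√2 (1 - m); the total rise is 1 - p, or else m = 1 and the
      -- term vanishes. As w has not been served yet, its charge is exactly its share.
      covers-N : ∀ {w} → N w → target ≤ A′ u + A′ w
      covers-N {w} Nw = ≤-trans (edge-bound p (y′ w))
        (subst₂ (λ a b → share p + 2# * √2 * (1# - y′ w) * (1# - p) + share (y′ w) ≤ a + b) (sym A′-u)
          (sym (A′-N Nw (pending w (proj₂ (proj₂ Nw)))))
          (+-monoˡ-≤ (share (y′ w)) (+-mono-≤ ≤-refl rest-bound)))
        where
        c : Carrier
        c = 2# * √2 * (1# - y′ w)
        rest-bound : c * (1# - p) ≤ ∑N I i u rest
        rest-bound = subst (_≤ ∑N I i u rest) (begin
            ∑N I i u (λ v → c * rise v)   ≡⟨ sum-cong-≗ (λ v → when-*ˡ (N? v) c (rise v)) ⟩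
            ∑[ v < n ] (c * when (N? v) (rise v)) ≡⟨ sum-* c (λ v → when (N? v) (rise v)) ⟩
            c * ∑N I i u rise             ≡⟨ *-assoc (2# * √2) (1# - y′ w) _ ⟩
            2# * √2 * ((1# - y′ w) * ∑N I i u rise) ≡⟨ cong (2# * √2 *_) (full-or-full Nw) ⟩
            2# * √2 * ((1# - y′ w) * (1# - p)) ≡⟨ *-assoc (2# * √2) (1# - y′ w) _ ⟨
            c * (1# - p) ∎)
          (sum-mono-≤ λ v → when-mono-≤ (N? v) λ _ → remainder-bound (x≤y⊔x (y w) ℓ))

      covers′ : ∀ {v w} → v ~ w → toℕ (position (deadline v)) ℕ.< suc (toℕ i) → target ≤ A′ v + A′ w
      covers′ {v} {w} v~w v≤i with ℕ.m<1+n⇒m<n∨m≡n v≤i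
      ... | inj₁ v<i = ≤-trans (covers v~w v<i) (+-mono-≤ (A≤A′ v) (A≤A′ w))
      ... | inj₂ v≡i with v≡u
        where
        v≡u : v ≡ u
        v≡u with trans (sym (Inverse.strictlyInverseˡ schedule (deadline v)))
                 (trans (cong event (trans (Fin.toℕ-injective v≡i) i≡)) (Inverse.strictlyInverseˡ schedule (deadline u)))
        ... | refl = refl
      ...   | refl with toℕ i ℕ.≤? toℕ (position (deadline w))
      ...     | yes i≤w = covers-N (v~w , ℕ.<⇒≤ arrived , i≤w)
        where
        arrived : toℕ (position (arrival w)) ℕ.< toℕ i
        arrived = subst (λ j → toℕ (position (arrival w)) ℕ.< j) (sym (cong toℕ i≡)) (proj₂ (arrivalsFirst (~-sym v~w)))
      -- The edge was covered at the earlier deadline of `w`, and charges only grow.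
      ...     | no i≰w = ≤-trans (subst (target ≤_) (+-comm (A w) (A u)) (covers (~-sym v~w) (ℕ.≰⇒> i≰w)))
                           (+-mono-≤ (A≤A′ u) (A≤A′ w))

      charges-deadline : Charges (suc (toℕ i)) x′
      charges-deadline = record
        { A = A′
        ; nonNeg = λ v → ≤-trans (nonNeg v) (A≤A′ v)
        ; total = total′
        ; pending = pending′
        ; covers = covers′ }

    charges : (ρ : Run I) → WaterFilling ρ → ∀ t → Charges (toℕ t) (Run.x ρ t)
    charges ρ wf = Fin.<-weakInduction (λ t → Charges (toℕ t) (x t)) (charges-initially initial) advance
      where
      open Run ρ
      advance : ∀ i → Charges (toℕ (inject₁ i)) (x (inject₁ i)) → Charges (suc (toℕ i)) (x (suc i))
      advance i C = serve (event i) refl (wf i) (subst (λ t → Charges t (x (inject₁ i))) (Fin.toℕ-inject₁ i) C)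
        where
        serve : ∀ e → event i ≡ e → WaterFillingStep I i e (x (inject₁ i)) (x (suc i)) →
                Charges (toℕ i) (x (inject₁ i)) → Charges (suc (toℕ i)) (x (suc i))
        serve (arrival v)  eq same    = charges-arrival eq same
        serve (deadline u) eq (_ , F) =
          Deadline.charges-deadline (sym (Inverse.inverseʳ schedule (sym eq))) (feasible (inject₁ i)) F

  -- Sum c ≤ A v + A w against the matching over ordered pairs; every row and column sum is at most
  -- 1. Applied with the charges for the ratio, and with c = 1 and a vertex cover to certify the
  -- optimum of the hard instances.
  weak-duality : ∀ {n} {G : SimpleGraph n} {x : EdgeValues n} → IsFractionalMatching G x →
                 ∀ {c} {A : Fin n → Carrier} → (∀ v → 0# ≤ A v) →
                 (∀ {v w} → SimpleGraph._~_ G v w → c ≤ A v + A w) →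
                 c * sum (level x) ≤ sum A + sum A
  weak-duality {n} {G} {x} M {c} {A} 0≤A covers = ≤-trans bound (+-mono-≤ saturated saturated)
    where
    open IsFractionalMatching M
    open SimpleGraph G
    entry : ∀ v w → c * x v w ≤ A v * x v w + A w * x v w
    entry v w with v ~? w
    ... | yes v~w = subst (c * x v w ≤_) (distribʳ (x v w) (A v) (A w)) (*-monoʳ-≤ (nonNeg v w) (covers v~w))
    ... | no v≁w = ≤-reflexive (subst (λ z → c * z ≡ A v * z + A w * z) (sym (support v w v≁w))
        (solve 3 (λ c a b → c :* # 0 := a :* # 0 :+ b :* # 0) refl c (A v) (A w)))
    weighted : Carrier
    weighted = ∑[ v < n ] (A v * level x v)
    saturated : weighted ≤ sum A
    saturated = sum-mono-≤ λ v → subst (A v * level x v ≤_) (*-identityʳ (A v)) (*-monoˡ-≤ (0≤A v) (level≤1 v))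
    rows : ∑[ v < n ] ∑[ w < n ] (A v * x v w) ≡ weighted
    rows = sum-cong-≗ λ v → sum-* (A v) (x v)
    columns : ∑[ v < n ] ∑[ w < n ] (A w * x v w) ≡ weighted
    columns = begin
      ∑[ v < n ] ∑[ w < n ] (A w * x v w) ≡⟨ ∑-comm (λ v w → A w * x v w) ⟩
      ∑[ w < n ] ∑[ v < n ] (A w * x v w) ≡⟨ sum-cong-≗ (λ w → sum-cong-≗ λ v → cong (A w *_) (symmetric v w)) ⟩
      ∑[ w < n ] ∑[ v < n ] (A w * x w v) ≡⟨ rows ⟩
      weighted ∎
    bound : c * sum (level x) ≤ weighted + weighted
    bound = subst₂ _≤_
      (trans (sum-cong-≗ λ v → sum-* c (x v)) (sum-* c (level x)))
      (trans (trans (sum-cong-≗ λ v → ∑-distrib-+ (λ w → A v * x v w) (λ w → A w * x v w))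
                    (∑-distrib-+ (λ v → ∑[ w < n ] (A v * x v w)) (λ v → ∑[ w < n ] (A w * x v w))))
             (cong₂ _+_ rows columns))
      (sum-mono-≤ λ v → sum-mono-≤ λ w → entry v w)

  0<2 : 0# < 2#
  0<2 = <-≤-trans 0<1 (x≤x+y 0≤1)

  waterFilling-competitive : Competitive WaterFilling (2# - √2)
  waterFilling-competitive I ρ wf opt isOPT with IsOPT.attained isOPT
  -- The factor 8 to be cancelled is the 4 that clears the denominators of φ times the 2 for
  -- counting edges from both ends.
  ... | x* , M* , refl = *-cancelˡ-≤ 0<2 (*-cancelˡ-≤ 0<2 (*-cancelˡ-≤ 0<2
    (subst₂ _≤_ left right (weak-duality M* nonNeg (λ {v} v~w → covers v~w (passed v)))))) 
    where
    open Instance I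
    open Run ρ
    open Charging I
    open Charges (charges ρ wf (fromℕ (n ℕ.+ n)))
    passed : ∀ v → toℕ (position (deadline v)) ℕ.< toℕ (fromℕ (n ℕ.+ n))
    passed v = subst (toℕ (position (deadline v)) ℕ.<_) (sym (Fin.toℕ-fromℕ _)) (Fin.toℕ<n _)
    left : target * sum (level x*) ≡ 2# * (2# * (2# * ((2# - √2) * value x*)))
    left = trans (cong (target *_) (value-double M*))
      (solve 2 (λ g v → # 2 :* # 2 :* g :* (v :+ v) := # 2 :* (# 2 :* (# 2 :* (g :* v)))) refl Γ₀ (value x*))
    right : sum A + sum A ≡ 2# * (2# * (2# * value output))
    right = trans (cong₂ _+_ total total) (trans (cong (λ s → 2# * s + 2# * s) (value-double (feasible _)))
      (solve 1 (λ v → # 2 :* (v :+ v) :+ # 2 :* (v :+ v) := # 2 :* (# 2 :* (# 2 :* v))) refl (value output)))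

  -- Hard instances

  -- An orientation of the edges towards the later deadline together with
  -- weights under which each vertex u, when its deadline comes, finds its
  -- out-neighbours at a common level and is filled by raising each by w u.
  record BalancedOrientation (I : Instance) : Set₁ where
    open Instance I
    infix 4 _⟶_ _⟶?_
    field
      _⟶_  : Fin n → Fin n → Set
      _⟶?_ : ∀ u v → Dec (u ⟶ v)
      w    : Fin n → Carrier
      w-nonNeg : ∀ u → 0# ≤ w u
      orient   : ∀ {u v} → u ~ v → u ⟶ v ⊎ v ⟶ u
      ⟶⇒~      : ∀ {u v} → u ⟶ v → u ~ v
      ⟶⇒<      : ∀ {u v} → u ⟶ v → toℕ (position (deadline u)) ℕ.< toℕ (position (deadline v))

    inflow : Fin n → Carrier
    inflow v = ∑[ u < n ] when (u ⟶? v) (w u)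

    field
      inflow≤1    : ∀ v → inflow v ≤ 1#
      -- Asked only of vertices with an out-neighbour: a sink keeps its passive level when its
      -- deadline comes.
      saturated   : ∀ {u v} → u ⟶ v → ∑[ v′ < n ] when (u ⟶? v′) (w u) ≡ 1# - inflow u
      synchronous : ∀ {t u v v′} → toℕ (position (deadline t)) ℕ.< toℕ (position (deadline u)) →
                    u ⟶ v → u ⟶ v′ → t ⟶ v → t ⟶ v′

  module _ {I : Instance} (B : BalancedOrientation I) where
    open Instance I
    open BalancedOrientation B

    private
      due : Fin n → ℕ
      due v = toℕ (position (deadline v))

      inflowBefore : ℕ → Fin n → Carrier
      inflowBefore t v = ∑[ u < n ] when (u ⟶? v) (when (due u ℕ.<? t) (w u))

      -- After its own deadline the level of a vertex also contains what it took actively, so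
      -- `pending` stops there. `total` survives, because every unit put on an edge is inflow of one
      -- end and raises the levels of both.
      record Levels (t : ℕ) (x : EdgeValues n) : Set where
        field
          pending : ∀ v → t ℕ.≤ due v → level x v ≡ inflowBefore t v
          total   : sum (level x) ≡ sum (inflowBefore t) + sum (inflowBefore t)

      inflowBefore-0 : ∀ v → inflowBefore 0 v ≡ 0#
      inflowBefore-0 v = sum-0 λ u → trans (when-cong (u ⟶? v) λ _ → when-no (due u ℕ.<? 0) {w u} λ ()) (when-0 (u ⟶? v))

      inflowBefore-all : ∀ {t v} → (∀ {u} → u ⟶ v → due u ℕ.< t) → inflowBefore t v ≡ inflow v
      inflowBefore-all {t} {v} passed =
        sum-cong-≗ λ u → when-cong (u ⟶? v) λ u⟶v → when-yes (due u ℕ.<? t) (passed u⟶v)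

      inflowBefore≤1 : ∀ t v → inflowBefore t v ≤ 1#
      inflowBefore≤1 t v = ≤-trans (sum-mono-≤ λ u → when-mono-≤ (u ⟶? v) λ _ → when-≤ (due u ℕ.<? t) (w-nonNeg u)) (inflow≤1 v)

      due-injective : ∀ {u v} → due u ≡ due v → u ≡ v
      due-injective {u} {v} eq with trans (sym (Inverse.strictlyInverseˡ schedule (deadline u)))
        (trans (cong event (Fin.toℕ-injective eq)) (Inverse.strictlyInverseˡ schedule (deadline v)))
      ... | refl = refl

      inflowBefore-suc : ∀ u v → inflowBefore (suc (due u)) v ≡ inflowBefore (due u) v + when (u ⟶? v) (w u)
      inflowBefore-suc u v = begin
        inflowBefore (suc (due u)) v
          ≡⟨ sum-cong-≗ split ⟩
        ∑[ t < n ] (when (t ⟶? v) (when (due t ℕ.<? due u) (w t)) + when (t Fin.≟ u) (when (t ⟶? v) (w t)))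
          ≡⟨ ∑-distrib-+ (λ t → when (t ⟶? v) (when (due t ℕ.<? due u) (w t))) (λ t → when (t Fin.≟ u) (when (t ⟶? v) (w t))) ⟩
        inflowBefore (due u) v + ∑[ t < n ] when (t Fin.≟ u) (when (t ⟶? v) (w t))
          ≡⟨ cong (inflowBefore (due u) v +_) (sum-point (λ t → when (t ⟶? v) (w t)) u) ⟩
        inflowBefore (due u) v + when (u ⟶? v) (w u) ∎
        where
        inner : ∀ t → Dec (t ≡ u) → when (due t ℕ.<? suc (due u)) (w t) ≡ when (due t ℕ.<? due u) (w t) + when (t Fin.≟ u) (w t)
        inner t (yes refl) = trans (when-yes (due u ℕ.<? suc (due u)) ℕ.≤-refl)
          (sym (trans (cong₂ _+_ (when-no (due u ℕ.<? due u) (ℕ.<-irrefl refl)) (when-yes (u Fin.≟ u) refl)) (+-identityˡ _)))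
        inner t (no t≢u) = trans (when-⇔ (due t ℕ.<? suc (due u)) (due t ℕ.<? due u)
            (λ t≤u → ℕ.≤∧≢⇒< (ℕ.s≤s⁻¹ t≤u) (λ eq → t≢u (due-injective eq))) ℕ.m<n⇒m<1+n)
          (sym (trans (cong (when (due t ℕ.<? due u) (w t) +_) (when-no (t Fin.≟ u) t≢u)) (+-identityʳ _)))
        split : ∀ t → when (t ⟶? v) (when (due t ℕ.<? suc (due u)) (w t)) ≡
                      when (t ⟶? v) (when (due t ℕ.<? due u) (w t)) + when (t Fin.≟ u) (when (t ⟶? v) (w t))
        split t with t ⟶? v
        ... | yes _ = inner t (t Fin.≟ u)
        ... | no _  = sym (trans (cong (0# +_) (when-0 (t Fin.≟ u))) (+-identityˡ 0#))

      levels-arrival : ∀ {i v x x′} → event i ≡ arrival v → (∀ a b → x′ a b ≡ x a b) →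
                       Levels (toℕ i) x → Levels (suc (toℕ i)) x′
      levels-arrival {i} {v} {x} {x′} eq same Lv = record
        { pending = λ v i<v → trans (level≡ v) (trans (pending v (ℕ.<⇒≤ i<v)) (sym (before v)))
        ; total = trans (sum-cong-≗ level≡) (trans total (sym (cong₂ _+_ (sum-cong-≗ before) (sum-cong-≗ before)))) }
        where
        open Levels Lv
        level≡ : ∀ v → level x′ v ≡ level x v
        level≡ v = sum-cong-≗ (same v)
        not-now : ∀ u → due u ≢ toℕ i
        not-now u due≡i with trans (sym eq) (Inverse.inverseˡ schedule (sym (Fin.toℕ-injective due≡i)))
        ... | ()
        before : ∀ v → inflowBefore (suc (toℕ i)) v ≡ inflowBefore (toℕ i) v
        before v = sum-cong-≗ λ u → when-cong (u ⟶? v) λ _ → when-⇔ (due u ℕ.<? suc (toℕ i)) (due u ℕ.<? toℕ i)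
          (λ u≤i → ℕ.≤∧≢⇒< (ℕ.s≤s⁻¹ u≤i) (not-now u)) ℕ.m<n⇒m<1+n

      module Deadline {i u x x′ ℓ} (i≡ : i ≡ position (deadline u))
                      (F : FillsTo I i u x x′ ℓ) (Lv : Levels (due u) x) where
        open Service I i u
        open FillsTo F using (ℓ≤1; rise) renaming (total to risen)
        open Levels Lv

        step : ∀ v w → x′ v w ≡ x v w + increment rise v w
        step = fills⇒increment F

        N⇒⟶ : ∀ {v} → N v → u ⟶ v
        N⇒⟶ {v} (u~v , _ , i≤v) with orient u~v
        ... | inj₁ u⟶v = u⟶v
        ... | inj₂ v⟶u = contradiction (⟶⇒< v⟶u) (ℕ.≤⇒≯ (subst (λ j → toℕ j ℕ.≤ due v) i≡ i≤v))

        ⟶⇒N : ∀ {v} → u ⟶ v → N v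
        ⟶⇒N {v} u⟶v rewrite i≡ =
          ⟶⇒~ u⟶v , ℕ.<⇒≤ (proj₂ (arrivalsFirst (~-sym (⟶⇒~ u⟶v)))) , ℕ.<⇒≤ (⟶⇒< u⟶v)

        level-N : ∀ {v} → N v → level x v ≡ inflowBefore (due u) v
        level-N {v} Nv = pending v (ℕ.<⇒≤ (⟶⇒< (N⇒⟶ Nv)))

        -- Bounded inflow means that no neighbour overflows, so the minimum that limits the total
        -- rise is the demand of u itself.
        room : ∀ {v} → N v → w u ≤ 1# - level x v
        room {v} Nv = difference-nonNeg (subst (0# ≤_)
          (solve 3 (λ o y w → o :- (y :+ w) := o :- y :- w) refl 1# (level x v) (w u))
          (nonNeg-difference (subst (_≤ 1#)
            (trans (inflowBefore-suc u v) (cong₂ _+_ (sym (level-N Nv)) (when-yes (u ⟶? v) (N⇒⟶ Nv))))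
            (inflowBefore≤1 (suc (due u)) v))))

        level-common : ∀ {v v′} → N v → N v′ → level x v ≡ level x v′
        level-common {v} {v′} Nv Nv′ = trans (level-N Nv) (trans (sum-cong-≗ same) (sym (level-N Nv′)))
          where
          same : ∀ t → when (t ⟶? v) (when (due t ℕ.<? due u) (w t)) ≡ when (t ⟶? v′) (when (due t ℕ.<? due u) (w t))
          same t = by-cases (due t ℕ.<? due u)
            where
            by-cases : (t<u : Dec (due t ℕ.< due u)) → when (t ⟶? v) (when t<u (w t)) ≡ when (t ⟶? v′) (when t<u (w t))
            by-cases (yes t<u) = when-⇔ (t ⟶? v) (t ⟶? v′) (synchronous t<u (N⇒⟶ Nv) (N⇒⟶ Nv′)) (synchronous t<u (N⇒⟶ Nv′) (N⇒⟶ Nv))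
            by-cases (no _)    = trans (when-0 (t ⟶? v)) (sym (when-0 (t ⟶? v′)))

        ∑N-const : ∀ c → ∑N I i u (λ _ → c) ≡ c * ∑N I i u (λ _ → 1#)
        ∑N-const c = trans (sum-cong-≗ λ v → trans (when-cong (N? v) (λ _ → sym (*-identityʳ c))) (when-*ˡ (N? v) c 1#))
          (sum-* c (λ v → when (N? v) 1#))

        -- Neighbours at a common level rise by a common amount. By `saturated`, equal rises of
        -- `w u` would also add up to the demand of u, and the number of neighbours cancels.
        rise≡w : ∀ {v} → N v → rise v ≡ w u
        rise≡w {v} Nv = *-cancelˡ-≡ degree≢0 (begin
          degree * rise v                    ≡⟨ *-comm degree (rise v) ⟩
          rise v * degree                    ≡⟨ ∑N-const (rise v) ⟨
          ∑N I i u (λ _ → rise v)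
            ≡⟨ sum-cong-≗ (λ v′ → when-cong (N? v′) λ Nv′ → cong (λ y → (y ⊔ ℓ) - y) (level-common Nv Nv′)) ⟩
          ∑N I i u rise                      ≡⟨ risen ⟩
          (1# - level x u) ⊓ ∑N I i u (λ v → 1# - level x v)
            ≡⟨ x≤y⇒x⊓y≈x (subst (_≤ _) demand (sum-mono-≤ λ v → when-mono-≤ (N? v) room)) ⟩
          1# - level x u                     ≡⟨ demand ⟨
          ∑N I i u (λ _ → w u)               ≡⟨ ∑N-const (w u) ⟩
          w u * degree                       ≡⟨ *-comm (w u) degree ⟩
          degree * w u                       ∎)
          where
          degree : Carrier
          degree = ∑N I i u (λ _ → 1#)
          degree≢0 : degree ≢ 0#
          degree≢0 = ≢-sym (proj₂ (<-≤-trans 0<1 (subst (_≤ degree) (when-yes (N? v) Nv)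
            (term≤sum (λ v → when-nonNeg (N? v) λ _ → 0≤1) v))))
          demand : ∑N I i u (λ _ → w u) ≡ 1# - level x u
          demand = trans (sum-cong-≗ λ v → when-⇔ (N? v) (u ⟶? v) N⇒⟶ ⟶⇒N)
            (trans (saturated (N⇒⟶ Nv)) (cong (λ p → 1# - p) (sym (trans (pending u ℕ.≤-refl) (inflowBefore-all ⟶⇒<)))))

        inflow-step : ∀ v → inflowBefore (suc (due u)) v ≡ inflowBefore (due u) v + when (N? v) (rise v)
        inflow-step v = trans (inflowBefore-suc u v) (cong (inflowBefore (due u) v +_)
          (trans (when-⇔ (u ⟶? v) (N? v) ⟶⇒N N⇒⟶) (when-cong (N? v) λ Nv → sym (rise≡w Nv))))

        sum-inflow-step : sum (inflowBefore (suc (due u))) ≡ sum (inflowBefore (due u)) + ∑N I i u rise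
        sum-inflow-step = trans (sum-cong-≗ inflow-step) (∑-distrib-+ (inflowBefore (due u)) (λ v → when (N? v) (rise v)))

        levels-deadline : Levels (suc (due u)) x′
        levels-deadline = record
          { pending = λ v u<v → trans (level-step-≢ {x} {x′} {rise} step {v} (λ { refl → ℕ.<-irrefl refl u<v }))
              (trans (cong (_+ when (N? v) (rise v)) (pending v (ℕ.<⇒≤ u<v))) (sym (inflow-step v)))
          ; total = begin
              sum (level x′)  ≡⟨ sum-level-step {x} {x′} {rise} step ⟩
              sum (level x) + (∑N I i u rise + ∑N I i u rise)
                ≡⟨ cong (_+ (∑N I i u rise + ∑N I i u rise)) total ⟩
              sum (inflowBefore (due u)) + sum (inflowBefore (due u)) + (∑N I i u rise + ∑N I i u rise)
                ≡⟨ solve 2 (λ f r → f :+ f :+ (r :+ r) := (f :+ r) :+ (f :+ r)) refl (sum (inflowBefore (due u))) (∑N I i u rise) ⟩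
              (sum (inflowBefore (due u)) + ∑N I i u rise) + (sum (inflowBefore (due u)) + ∑N I i u rise)
                ≡⟨ cong₂ _+_ sum-inflow-step sum-inflow-step ⟨
              sum (inflowBefore (suc (due u))) + sum (inflowBefore (suc (due u))) ∎ }

      levels : (ρ : Run I) → WaterFilling ρ → ∀ t → Levels (toℕ t) (Run.x ρ t)
      levels ρ wf = Fin.<-weakInduction (λ t → Levels (toℕ t) (x t)) start advance
        where
        open Run ρ
        start : Levels 0 (x zero)
        start = record
          { pending = λ v _ → trans (sum-0 (initial v)) (sym (inflowBefore-0 v))
          ; total = trans (sum-0 λ v → sum-0 (initial v))
              (sym (trans (cong₂ _+_ (sum-0 inflowBefore-0) (sum-0 inflowBefore-0)) (+-identityˡ 0#))) }
        advance : ∀ i → Levels (toℕ (inject₁ i)) (x (inject₁ i)) → Levels (suc (toℕ i)) (x (suc i))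
        advance i Lv = serve (event i) refl (wf i) (subst (λ t → Levels t (x (inject₁ i))) (Fin.toℕ-inject₁ i) Lv)
          where
          serve : ∀ e → event i ≡ e → WaterFillingStep I i e (x (inject₁ i)) (x (suc i)) →
                  Levels (toℕ i) (x (inject₁ i)) → Levels (suc (toℕ i)) (x (suc i))
          serve (arrival v)  eq same    Lv = levels-arrival eq same Lv
          serve (deadline u) eq (_ , F) Lv = subst (λ t → Levels (suc t) (x (suc i))) (sym i≡)
            (Deadline.levels-deadline pos≡ F (subst (λ t → Levels t (x (inject₁ i))) i≡ Lv))
            where
            pos≡ : i ≡ position (deadline u)
            pos≡ = sym (Inverse.inverseʳ schedule (sym eq))
            i≡ : toℕ i ≡ due u
            i≡ = cong toℕ pos≡

    balanced-value : ∀ (ρ : Run I) → WaterFilling ρ → value (Run.output ρ) ≡ sum inflow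
    balanced-value ρ wf = *-cancelˡ-≡ (≢-sym (proj₂ 0<2)) (begin
      2# * value output           ≡⟨ solve 1 (λ a → # 2 :* a := a :+ a) refl (value output) ⟩
      value output + value output ≡⟨ value-double (feasible _) ⟨
      sum (level output)          ≡⟨ Levels.total (levels ρ wf (fromℕ (n ℕ.+ n))) ⟩
      sum (inflowBefore last) + sum (inflowBefore last)
        ≡⟨ cong₂ _+_ (sum-cong-≗ final) (sum-cong-≗ final) ⟩
      sum inflow + sum inflow     ≡⟨ solve 1 (λ a → a :+ a := # 2 :* a) refl (sum inflow) ⟩
      2# * sum inflow             ∎)
      where
      open Run ρ
      last : ℕ
      last = toℕ (fromℕ (n ℕ.+ n))
      final : ∀ v → inflowBefore last v ≡ inflow v
      final v = inflowBefore-all λ {u} _ → subst (due u ℕ.<_) (sym (Fin.toℕ-fromℕ _)) (Fin.toℕ<n _)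

  -- Natural numbers in the field, counting sums and lists

  module Embedding where
    open UnaryMult semiring using (×-homo-+; ×1-homo-*; ×-assoc-*)

    ι : ℕ → Carrier
    ι m = m · 1#

    ι-+ : ∀ m n → ι (m ℕ.+ n) ≡ ι m + ι n
    ι-+ = ×-homo-+ 1#

    ι-* : ∀ m n → ι (m ℕ.* n) ≡ ι m * ι n
    ι-* = ×1-homo-*

    ·≡ι* : ∀ m x → m · x ≡ ι m * x
    ·≡ι* m x = sym (trans (×-assoc-* m 1# x) (cong (m ·_) (*-identityˡ x)))

    ι-nonNeg : ∀ m → 0# ≤ ι m
    ι-nonNeg zero    = ≤-refl
    ι-nonNeg (suc m) = +-nonNeg 0≤1 (ι-nonNeg m)

    ι-mono-≤ : ∀ {m n} → m ℕ.≤ n → ι m ≤ ι n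
    ι-mono-≤ {n = n} ℕ.z≤n = ι-nonNeg n
    ι-mono-≤ (ℕ.s≤s m≤n) = +-mono-≤ ≤-refl (ι-mono-≤ m≤n)

    ι-pos : ∀ {m} → 1 ℕ.≤ m → 0# < ι m
    ι-pos {m} 1≤m = <-≤-trans 0<1 (subst (_≤ ι m) (+-identityʳ 1#) (ι-mono-≤ {1} {m} 1≤m))

    infix 9 1/_
    1/_ : ℕ → Carrier
    1/ zero  = 0#
    1/ suc m = proj₁ (inverse (ι (suc m)) (≢-sym (proj₂ (ι-pos {suc m} (ℕ.s≤s ℕ.z≤n)))))

    *-1/ : ∀ {m} → 1 ℕ.≤ m → ι m * 1/ m ≡ 1#
    *-1/ {suc m} _ = proj₂ (inverse (ι (suc m)) _)

    1/-nonNeg : ∀ m → 0# ≤ 1/ m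
    1/-nonNeg zero = ≤-refl
    1/-nonNeg (suc m) = *-cancelˡ-≤ (ι-pos {suc m} (ℕ.s≤s ℕ.z≤n))
      (subst₂ _≤_ (sym (zeroʳ (ι (suc m)))) (sym (*-1/ {suc m} (ℕ.s≤s ℕ.z≤n))) 0≤1)

  open Embedding public

  -- Telescoping. It turns the recurrence for `flow` into the number of vertices that a group
  -- raises.
  tail-sum : ∀ {K} (c : Fin K → Carrier) (f : ℕ → Carrier) → f K ≡ 0# →
             (∀ i → c i + f (suc (toℕ i)) ≡ f (toℕ i)) →
             ∀ {a} → a ℕ.≤ K → ∑[ i < K ] when (a ℕ.≤? toℕ i) (c i) ≡ f a
  tail-sum {zero}  c f fK≡0 rec {zero}  _ = sym fK≡0
  tail-sum {suc K} c f fK≡0 rec {zero}  _ = trans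
    (cong (c zero +_) (tail-sum (λ i → c (suc i)) (λ a → f (suc a)) fK≡0 (λ i → rec (suc i)) ℕ.z≤n))
    (rec zero)
  tail-sum {suc K} c f fK≡0 rec {suc a} (ℕ.s≤s a≤K) = begin
    0# + ∑[ i < K ] when (suc a ℕ.≤? suc (toℕ i)) (c (suc i))
      ≡⟨ +-identityˡ _ ⟩
    ∑[ i < K ] when (suc a ℕ.≤? suc (toℕ i)) (c (suc i))
      ≡⟨ sum-cong-≗ {K} (λ i → when-⇔ (suc a ℕ.≤? suc (toℕ i)) (a ℕ.≤? toℕ i) {c (suc i)} ℕ.s≤s⁻¹ ℕ.s≤s) ⟩
    ∑[ i < K ] when (a ℕ.≤? toℕ i) (c (suc i))
      ≡⟨ tail-sum (λ i → c (suc i)) (λ a → f (suc a)) fK≡0 (λ i → rec (suc i)) a≤K ⟩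
    f (suc a) ∎

  prefix-sum : ∀ {K} (e : Fin K) c → ∑[ i < K ] when (toℕ i ℕ.≤? toℕ e) c ≡ ι (suc (toℕ e)) * c
  prefix-sum {suc K} zero c = trans (cong (c +_) (sum-replicate-zero K))
    (solve 1 (λ c → c :+ # 0 := (# 1 :+ # 0) :* c) refl c)
  prefix-sum {suc K} (suc e) c = begin
    c + ∑[ i < K ] when (suc (toℕ i) ℕ.≤? suc (toℕ e)) c
      ≡⟨ cong (c +_) (sum-cong-≗ {K} λ i → when-⇔ (suc (toℕ i) ℕ.≤? suc (toℕ e)) (toℕ i ℕ.≤? toℕ e) {c} ℕ.s≤s⁻¹ ℕ.s≤s) ⟩
    c + ∑[ i < K ] when (toℕ i ℕ.≤? toℕ e) c
      ≡⟨ cong (c +_) (prefix-sum e c) ⟩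
    c + ι (suc (toℕ e)) * c
      ≡⟨ solve 2 (λ c m → c :+ m :* c := (# 1 :+ m) :* c) refl c (ι (suc (toℕ e))) ⟩
    ι (suc (suc (toℕ e))) * c ∎

  bounded-count : ∀ g c → ∑[ k < suc g ] when (toℕ k ℕ.<? g) c ≡ ι g * c
  bounded-count zero    c = trans (+-identityˡ 0#) (sym (zeroˡ c))
  bounded-count (suc g) c = begin
    c + ∑[ k < suc g ] when (suc (toℕ k) ℕ.<? suc g) c
      ≡⟨ cong (c +_) (sum-cong-≗ {suc g} λ k → when-⇔ (suc (toℕ k) ℕ.<? suc g) (toℕ k ℕ.<? g) {c} ℕ.s≤s⁻¹ ℕ.s≤s) ⟩
    c + ∑[ k < suc g ] when (toℕ k ℕ.<? g) c
      ≡⟨ cong (c +_) (bounded-count g c) ⟩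
    c + ι g * c
      ≡⟨ solve 2 (λ c m → c :+ m :* c := (# 1 :+ m) :* c) refl c (ι g) ⟩
    ι (suc g) * c ∎

  sum-const : ∀ n c → ∑[ _ < n ] c ≡ ι n * c
  sum-const n c = trans (sum-replicate n) (·≡ι* n c)

  sum-opposite : ∀ {n} (f : Fin n → Carrier) → sum f ≡ ∑[ i < n ] f (opposite i)
  sum-opposite f = ∑-permute f Permutation.reverse

  module _ {A : Set} (f : A → Carrier) where

    sumOver : List A → Carrier
    sumOver []       = 0#
    sumOver (a ∷ as) = f a + sumOver as

    sum-lookup : ∀ as → ∑[ i < List.length as ] f (List.lookup as i) ≡ sumOver as
    sum-lookup []       = refl
    sum-lookup (a ∷ as) = cong (f a +_) (sum-lookup as)

    sumOver-++ : ∀ as bs → sumOver (as ++ bs) ≡ sumOver as + sumOver bs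
    sumOver-++ []       bs = sym (+-identityˡ _)
    sumOver-++ (a ∷ as) bs = trans (cong (f a +_) (sumOver-++ as bs)) (sym (+-assoc _ _ _))

    sumOver-replicate : ∀ m a → sumOver (List.replicate m a) ≡ ι m * f a
    sumOver-replicate zero    a = sym (zeroˡ (f a))
    sumOver-replicate (suc m) a = trans (cong (f a +_) (sumOver-replicate m a))
      (solve 2 (λ c m → c :+ m :* c := (# 1 :+ m) :* c) refl (f a) (ι m))

    sumOver-concat : ∀ {n} (g : Fin n → List A) → sumOver (List.concat (List.tabulate g)) ≡ ∑[ i < n ] sumOver (g i)
    sumOver-concat {zero}  g = refl
    sumOver-concat {suc n} g = trans (sumOver-++ (g zero) _) (cong (sumOver (g zero) +_) (sumOver-concat (λ i → g (suc i))))

  module _ {A : Set} {R : A → A → Set} where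

    AllPairs-lookup : ∀ {as} → AllPairs R as → ∀ {i j} → i Fin.< j → R (List.lookup as i) (List.lookup as j)
    AllPairs-lookup {a ∷ as} (Ra ∷ _)  {zero}  {suc j} _           = All.lookup Ra (List.∈-lookup j)
    AllPairs-lookup {a ∷ as} (_ ∷ Ras) {suc i} {suc j} (ℕ.s≤s i<j) = AllPairs-lookup Ras i<j

    All⇒AllPairs : ∀ {P : A → Set} {as} → (∀ {a b} → P a → P b → R a b) → All P as → AllPairs R as
    All⇒AllPairs PPR []         = []
    All⇒AllPairs PPR (Pa ∷ Pas) = All.map (PPR Pa) Pas ∷ All⇒AllPairs PPR Pas

  -- All vertices arrive before the first deadline, and everything happens at
  -- time 0; the deadlines are processed in the order of Fin n.
  static : ∀ {n} → SimpleGraph n → Instance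
  static {n} G = record
    { n = n
    ; graph = G
    ; r = λ _ → 0#
    ; d = λ _ → 0#
    ; r≤d = λ _ → ≤-refl
    ; intersect = λ _ → 0# , (≤-refl , ≤-refl) , (≤-refl , ≤-refl)
    ; schedule = schedule
    ; chronological = λ {i} {j} _ → ≤-reflexive (trans (time-0 (Inverse.to schedule i)) (sym (time-0 (Inverse.to schedule j))))
    ; arrivalsFirst = λ {u} {v} _ → arrival<deadline u u , arrival<deadline u v }
    where
    events : (Fin n ⊎ Fin n) ↔ Event n
    events = mk↔ₛ′ (λ { (inj₁ v) → arrival v ; (inj₂ v) → deadline v })
                   (λ { (arrival v) → inj₁ v ; (deadline v) → inj₂ v })
                   (λ { (arrival _) → refl ; (deadline _) → refl })
                   (λ { (inj₁ _) → refl ; (inj₂ _) → refl })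
    schedule : Fin (n ℕ.+ n) ↔ Event n
    schedule = events ↔-∘ Fin.+↔⊎
    time-0 : ∀ (e : Event n) → eventTime (λ _ → 0#) (λ _ → 0#) e ≡ 0#
    time-0 (arrival _)  = refl
    time-0 (deadline _) = refl
    arrival<deadline : ∀ u v → (u ↑ˡ n) Fin.< (n ↑ʳ v)
    arrival<deadline u v = subst₂ ℕ._<_ (sym (Fin.toℕ-↑ˡ u n)) (sym (Fin.toℕ-↑ʳ n v))
      (ℕ.<-≤-trans (Fin.toℕ<n u) (ℕ.m≤m+n n (toℕ v)))

  static-deadline : ∀ {n} (G : SimpleGraph n) v → toℕ (Instance.position (static G) (deadline v)) ≡ n ℕ.+ toℕ v
  static-deadline {n} G v = Fin.toℕ-↑ʳ n v

  sum-unique : ∀ {n} {P : Fin n → Set} (P? : ∀ i → Dec (P i)) (f : Fin n → Carrier) {j} →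
               P j → (∀ {i} → P i → i ≡ j) → ∑[ i < n ] when (P? i) (f i) ≡ f j
  sum-unique {n} P? f {j} Pj unique = trans
    (sum-cong-≗ λ i → when-⇔ (P? i) (i Fin.≟ j) {f i} unique (λ { refl → Pj })) (sum-point f j)

  sum-none : ∀ {n} {P : Fin n → Set} (P? : ∀ i → Dec (P i)) (f : Fin n → Carrier) →
             (∀ i → ¬ P i) → ∑[ i < n ] when (P? i) (f i) ≡ 0#
  sum-none P? f none = sum-0 λ i → when-no (P? i) (none i)

  -- The layered instance and its levels

  data Role : Set where
    server client : Role

  module Layered {E K : ℕ} (ST : SquareTriangular E K) (G : ℕ) where
    open Counts ST

    Vertex : Set
    Vertex = Fin (suc G) × Fin K × Role

    -- The servers of generation 0 are at level 0 at their deadlines, so that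
    -- fewer of them do the work of a later group.
    multiplicity : Fin (suc G) → Fin K → Role → ℕ
    multiplicity zero    i server = width i ℕ.* stock i
    multiplicity zero    i client = 0
    multiplicity (suc _) i _      = pool i

    -- The last group of the preceding generation that raises the vertex, so its passive level is
    -- (exit + 1)/L. The reversal for servers gives the groups that act first the highest levels and
    -- makes the levels of a server and a client of one group add up to a constant.
    exit : Fin K → Role → Fin K
    exit i server = opposite i
    exit i client = i

    infix 4 _⟶ⱽ_ _⟶ⱽ?_
    _⟶ⱽ_ : Vertex → Vertex → Set
    (k , i , client) ⟶ⱽ _ = ⊥
    (k , i , server) ⟶ⱽ (k′ , i′ , ρ) = toℕ k′ ≡ suc (toℕ k) × toℕ i ℕ.≤ toℕ (exit i′ ρ)

    _⟶ⱽ?_ : ∀ a b → Dec (a ⟶ⱽ b)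
    (k , i , client) ⟶ⱽ? _ = no λ ()
    (k , i , server) ⟶ⱽ? (k′ , i′ , ρ) = (toℕ k′ ℕ.≟ suc (toℕ k)) ×-dec (toℕ i ℕ.≤? toℕ (exit i′ ρ))

    InBlock : Fin (suc G) → Fin K → Vertex → Set
    InBlock k i (k′ , i′ , _) = k′ ≡ k × i′ ≡ i

    block : Fin (suc G) → Fin K → List Vertex
    block k i = List.replicate (multiplicity k i server) (k , i , server)
             ++ List.replicate (multiplicity k i client) (k , i , client)

    generation : Fin (suc G) → List Vertex
    generation k = List.concat (List.tabulate (block k))

    vertices : List Vertex
    vertices = List.concat (List.tabulate generation)

    infix 4 _≼_
    -- Only a preorder, blind to roles and to the copies inside a block: the order of deadlines
    -- there is immaterial, because the servers of a block have the same out-neighbours and its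
    -- clients have none.
    _≼_ : Vertex → Vertex → Set
    (k , i , _) ≼ (k′ , i′ , _) = toℕ k ℕ.< toℕ k′ ⊎ (k ≡ k′ × toℕ i ℕ.≤ toℕ i′)

    private
      block-inBlock : ∀ k i → All (InBlock k i) (block k i)
      block-inBlock k i = All.++⁺ (All.replicate⁺ (multiplicity k i server) (refl , refl))
                                  (All.replicate⁺ (multiplicity k i client) (refl , refl))

      generation-gen : ∀ k → All (λ a → proj₁ a ≡ k) (generation k)
      generation-gen k = All.concat⁺ (All.tabulate⁺ λ i → All.map proj₁ (block-inBlock k i))

      generation-sorted : ∀ k → AllPairs _≼_ (generation k)
      generation-sorted k = AllPairs.concat⁺
        (All.tabulate⁺ λ i → All⇒AllPairs (λ { (refl , refl) (refl , refl) → inj₂ (refl , ℕ.≤-refl) }) (block-inBlock k i))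
        (AllPairs.tabulate⁺-< λ {i} {j} i<j →
          All.map (λ { (refl , refl) → All.map (λ { (refl , refl) → inj₂ (refl , ℕ.<⇒≤ i<j) }) (block-inBlock k j) }) (block-inBlock k i))

    vertices-sorted : AllPairs _≼_ vertices
    vertices-sorted = AllPairs.concat⁺ (All.tabulate⁺ generation-sorted)
      (AllPairs.tabulate⁺-< λ {k} {k′} k<k′ →
        All.map (λ { refl → All.map (λ { refl → inj₁ k<k′ }) (generation-gen k′) }) (generation-gen k))

    size : ℕ
    size = List.length vertices

    vertex : Fin size → Vertex
    vertex = List.lookup vertices

    sum-vertices : ∀ (f : Vertex → Carrier) → ∑[ v < size ] f (vertex v) ≡
      ∑[ k < suc G ] ∑[ i < K ] (ι (multiplicity k i server) * f (k , i , server) + ι (multiplicity k i client) * f (k , i , client))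
    sum-vertices f = begin
      ∑[ v < size ] f (vertex v)                 ≡⟨ sum-lookup f vertices ⟩
      sumOver f vertices                         ≡⟨ sumOver-concat f generation ⟩
      ∑[ k < suc G ] sumOver f (generation k)    ≡⟨ sum-cong-≗ {suc G} (λ k → sumOver-concat f (block k)) ⟩
      ∑[ k < suc G ] ∑[ i < K ] sumOver f (block k i)
        ≡⟨ sum-cong-≗ {suc G} (λ k → sum-cong-≗ {K} λ i → trans
             (sumOver-++ f (List.replicate (multiplicity k i server) (k , i , server)) (List.replicate (multiplicity k i client) (k , i , client)))
             (cong₂ _+_ (sumOver-replicate f (multiplicity k i server) (k , i , server))
                        (sumOver-replicate f (multiplicity k i client) (k , i , client)))) ⟩
      ∑[ k < suc G ] ∑[ i < K ] (ι (multiplicity k i server) * f (k , i , server) + ι (multiplicity k i client) * f (k , i , client)) ∎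

    1≤L : 1 ℕ.≤ L
    1≤L = ℕ.s≤s ℕ.z≤n

    1≤stock : ∀ i → 1 ℕ.≤ stock i
    1≤stock i = count-pos (ℕ.≤-reflexive (toℕ+opposite i)) (ℕ.s≤s ℕ.z≤n)

    1≤pool : ∀ i → 1 ℕ.≤ pool i
    1≤pool i = ℕ.*-mono-≤ 1≤L (1≤stock i)

    1≤servers : ∀ k i → 1 ℕ.≤ multiplicity k i server
    1≤servers zero    i = ℕ.*-mono-≤ {1} {width i} (ℕ.s≤s ℕ.z≤n) (1≤stock i)
    1≤servers (suc _) i = 1≤pool i

    width≤L : ∀ i → width i ℕ.≤ L
    width≤L i = ℕ.s≤s (ℕ.+-monoʳ-≤ E (ℕ.<⇒≤ (Fin.toℕ<n i)))

    servers≤pool : ∀ k i → multiplicity k i server ℕ.≤ pool i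
    servers≤pool zero    i = ℕ.*-monoˡ-≤ (stock i) (width≤L i)
    servers≤pool (suc _) i = ℕ.≤-refl

    -- Reversing the index in the server sum turns both conditions into i ≤ j, so that servers and
    -- clients leaving at the same step are counted together, as in `flow-recurrence`.
    demand : ∀ i W → ∑[ j < K ] (ι (pool j) * when (toℕ i ℕ.≤? toℕ (opposite j)) W + ι (pool j) * when (toℕ i ℕ.≤? toℕ j) W)
                     ≡ ι (width i ℕ.* pool i) * W
    demand i W = begin
      ∑[ j < K ] (ι (pool j) * when (toℕ i ℕ.≤? toℕ (opposite j)) W + ι (pool j) * when (toℕ i ℕ.≤? toℕ j) W)
        ≡⟨ ∑-distrib-+ {K} (λ j → ι (pool j) * when (toℕ i ℕ.≤? toℕ (opposite j)) W) (λ j → ι (pool j) * when (toℕ i ℕ.≤? toℕ j) W) ⟩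
      ∑[ j < K ] (ι (pool j) * when (toℕ i ℕ.≤? toℕ (opposite j)) W) + ∑[ j < K ] (ι (pool j) * when (toℕ i ℕ.≤? toℕ j) W)
        ≡⟨ cong (_+ ∑[ j < K ] (ι (pool j) * when (toℕ i ℕ.≤? toℕ j) W)) (trans
             (sum-opposite (λ j → ι (pool j) * when (toℕ i ℕ.≤? toℕ (opposite j)) W))
             (sum-cong-≗ {K} λ j → cong (λ j′ → ι (pool (opposite j)) * when (toℕ i ℕ.≤? toℕ j′) W) (Fin.opposite-involutive j))) ⟩
      ∑[ j < K ] (ι (pool (opposite j)) * when (toℕ i ℕ.≤? toℕ j) W) + ∑[ j < K ] (ι (pool j) * when (toℕ i ℕ.≤? toℕ j) W)
        ≡⟨ ∑-distrib-+ {K} (λ j → ι (pool (opposite j)) * when (toℕ i ℕ.≤? toℕ j) W) (λ j → ι (pool j) * when (toℕ i ℕ.≤? toℕ j) W) ⟨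
      ∑[ j < K ] (ι (pool (opposite j)) * when (toℕ i ℕ.≤? toℕ j) W + ι (pool j) * when (toℕ i ℕ.≤? toℕ j) W)
        ≡⟨ sum-cong-≗ {K} (λ j → trans (sym (distribʳ (when (toℕ i ℕ.≤? toℕ j) W) (ι (pool (opposite j))) (ι (pool j))))
             (sym (when-*ˡ (toℕ i ℕ.≤? toℕ j) (ι (pool (opposite j)) + ι (pool j)) W))) ⟩
      ∑[ j < K ] when (toℕ i ℕ.≤? toℕ j) ((ι (pool (opposite j)) + ι (pool j)) * W)
        ≡⟨ tail-sum (λ j → (ι (pool (opposite j)) + ι (pool j)) * W) (λ a → ι (flow a) * W) flow-K flow-rec (ℕ.<⇒≤ (Fin.toℕ<n i)) ⟩
      ι (flow (toℕ i)) * W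
        ≡⟨ cong (λ m → ι m * W) (flow-toℕ i) ⟩
      ι (width i ℕ.* pool i) * W ∎
      where
      flow-K : ι (flow K) * W ≡ 0#
      flow-K = trans (cong (λ m → ι m * W) flow-end) (zeroˡ W)
      flow-rec : ∀ j → (ι (pool (opposite j)) + ι (pool j)) * W + ι (flow (suc (toℕ j))) * W ≡ ι (flow (toℕ j)) * W
      flow-rec j = begin
        (ι (pool (opposite j)) + ι (pool j)) * W + ι (flow (suc (toℕ j))) * W
          ≡⟨ distribʳ W _ _ ⟨
        (ι (pool (opposite j)) + ι (pool j) + ι (flow (suc (toℕ j)))) * W
          ≡⟨ cong (λ s → (s + ι (flow (suc (toℕ j)))) * W) (ι-+ (pool (opposite j)) (pool j)) ⟨
        (ι (pool (opposite j) ℕ.+ pool j) + ι (flow (suc (toℕ j)))) * W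
          ≡⟨ cong (_* W) (trans (sym (ι-+ (pool (opposite j) ℕ.+ pool j) (flow (suc (toℕ j))))) (cong ι (flow-recurrence j))) ⟩
        ι (flow (toℕ j)) * W ∎

    -- The rise of 1/L due to a group is split evenly among its servers.
    weight : Vertex → Carrier
    weight (k , i , server) = 1/ L * 1/ multiplicity k i server
    weight (k , i , client) = 0#

    weight-nonNeg : ∀ a → 0# ≤ weight a
    weight-nonNeg (k , i , server) = *-nonNeg (1/-nonNeg L) (1/-nonNeg (multiplicity k i server))
    weight-nonNeg (k , i , client) = ≤-refl

    inflowⱽ : Vertex → Carrier
    inflowⱽ b = ∑[ u < size ] when (vertex u ⟶ⱽ? b) (weight (vertex u))

    inflow-sum : ∀ k i ρ → inflowⱽ (k , i , ρ) ≡
                 ∑[ l < suc G ] when (toℕ k ℕ.≟ suc (toℕ l)) (ι (suc (toℕ (exit i ρ))) * 1/ L)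
    inflow-sum k i ρ = trans (sum-vertices (λ a → when (a ⟶ⱽ? (k , i , ρ)) (weight a)))
      (sum-cong-≗ {suc G} λ l → trans (sum-cong-≗ {K} (term l)) (trans
        (when-sum {n = K} (toℕ k ℕ.≟ suc (toℕ l)) (λ j → when (toℕ j ℕ.≤? toℕ (exit i ρ)) (1/ L)))
        (when-cong (toℕ k ℕ.≟ suc (toℕ l)) λ _ → prefix-sum (exit i ρ) (1/ L))))
      where
      term : ∀ l j → ι (multiplicity l j server) * when ((l , j , server) ⟶ⱽ? (k , i , ρ)) (weight (l , j , server))
                   + ι (multiplicity l j client) * 0#
                   ≡ when (toℕ k ℕ.≟ suc (toℕ l)) (when (toℕ j ℕ.≤? toℕ (exit i ρ)) (1/ L))
      term l j = begin
        m * when D (1/ L * 1/ multiplicity l j server) + ι (multiplicity l j client) * 0#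
          ≡⟨ trans (cong (m * when D (1/ L * 1/ multiplicity l j server) +_) (zeroʳ _)) (+-identityʳ _) ⟩
        m * when D (1/ L * 1/ multiplicity l j server)
          ≡⟨ when-*ˡ D m _ ⟨
        when D (m * (1/ L * 1/ multiplicity l j server))
          ≡⟨ when-cong D (λ _ → cancel) ⟩
        when D (1/ L)
          ≡⟨ when-× (toℕ k ℕ.≟ suc (toℕ l)) (toℕ j ℕ.≤? toℕ (exit i ρ)) ⟩
        when (toℕ k ℕ.≟ suc (toℕ l)) (when (toℕ j ℕ.≤? toℕ (exit i ρ)) (1/ L)) ∎
        where
        m : Carrier
        m = ι (multiplicity l j server)
        D : Dec ((l , j , server) ⟶ⱽ (k , i , ρ))
        D = (l , j , server) ⟶ⱽ? (k , i , ρ)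
        cancel : m * (1/ L * 1/ multiplicity l j server) ≡ 1/ L
        cancel = begin
          m * (1/ L * 1/ multiplicity l j server) ≡⟨ solve 3 (λ a b c → a :* (b :* c) := b :* (a :* c)) refl m (1/ L) _ ⟩
          1/ L * (m * 1/ multiplicity l j server) ≡⟨ cong (1/ L *_) (*-1/ (1≤servers l j)) ⟩
          1/ L * 1#                               ≡⟨ *-identityʳ _ ⟩
          1/ L ∎

    inflow-zero : ∀ i ρ → inflowⱽ (zero , i , ρ) ≡ 0#
    inflow-zero i ρ = trans (inflow-sum zero i ρ)
      (sum-none (λ l → 0 ℕ.≟ suc (toℕ l)) (λ (_ : Fin (suc G)) → ι (suc (toℕ (exit i ρ))) * 1/ L) λ _ ())

    inflow-suc : ∀ k i ρ → inflowⱽ (suc k , i , ρ) ≡ ι (suc (toℕ (exit i ρ))) * 1/ L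
    inflow-suc k i ρ = trans (inflow-sum (suc k) i ρ)
      (sum-unique (λ l → suc (toℕ k) ℕ.≟ suc (toℕ l)) (λ _ → ι (suc (toℕ (exit i ρ))) * 1/ L)
        (cong suc (sym (Fin.toℕ-inject₁ k)))
        (λ eq → Fin.toℕ-injective (trans (sym (ℕ.suc-injective eq)) (sym (Fin.toℕ-inject₁ k)))))

    inflowⱽ≤1 : ∀ a → inflowⱽ a ≤ 1#
    inflowⱽ≤1 (zero  , i , ρ) = subst (_≤ 1#) (sym (inflow-zero i ρ)) 0≤1
    inflowⱽ≤1 (suc k , i , ρ) = subst₂ _≤_ (sym (inflow-suc k i ρ)) (*-1/ 1≤L)
      (*-monoʳ-≤ (1/-nonNeg L) (ι-mono-≤ {suc (toℕ (exit i ρ))} {L}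
        (ℕ.≤-trans (Fin.toℕ<n (exit i ρ)) (ℕ.m≤n⇒m≤1+n (ℕ.m≤n+m K E)))))

    -- The next generation is given in the form `suc l`, where `multiplicity` reduces to `pool` for
    -- both roles.
    outflow : ∀ k i {l} → toℕ (Fin.suc l) ≡ suc (toℕ k) → ∀ W →
              ∑[ v < size ] when ((k , i , server) ⟶ⱽ? vertex v) W ≡ ι (width i ℕ.* pool i) * W
    outflow k i {l} l≡1+k W = begin
      ∑[ v < size ] when ((k , i , server) ⟶ⱽ? vertex v) W
        ≡⟨ sum-vertices (λ b → when ((k , i , server) ⟶ⱽ? b) W) ⟩
      ∑[ m < suc G ] ∑[ j < K ] (ι (multiplicity m j server) * when ((k , i , server) ⟶ⱽ? (m , j , server)) W
                               + ι (multiplicity m j client) * when ((k , i , server) ⟶ⱽ? (m , j , client)) W)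
        ≡⟨ sum-cong-≗ {suc G} (λ m → trans (sum-cong-≗ {K} (term m)) (when-sum {n = K} (toℕ m ℕ.≟ suc (toℕ k)) (inner m))) ⟩
      ∑[ m < suc G ] when (toℕ m ℕ.≟ suc (toℕ k)) (sum (inner m))
        ≡⟨ sum-unique (λ m → toℕ m ℕ.≟ suc (toℕ k)) (λ m → sum (inner m)) {suc l} l≡1+k
             (λ m≡1+k → Fin.toℕ-injective (trans m≡1+k (sym l≡1+k))) ⟩
      sum (inner (suc l))
        ≡⟨ demand i W ⟩
      ι (width i ℕ.* pool i) * W ∎
      where
      inner : Fin (suc G) → Fin K → Carrier
      inner m j = ι (multiplicity m j server) * when (toℕ i ℕ.≤? toℕ (opposite j)) W
                + ι (multiplicity m j client) * when (toℕ i ℕ.≤? toℕ j) W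
      pull : ∀ {p q} {P : Set p} {Q : Set q} (P? : Dec P) (Q? : Dec Q) c →
             c * when (P? ×-dec Q?) W ≡ when P? (c * when Q? W)
      pull P? Q? c = trans (cong (c *_) (when-× P? Q?)) (sym (when-*ˡ P? c (when Q? W)))
      term : ∀ m j → ι (multiplicity m j server) * when ((k , i , server) ⟶ⱽ? (m , j , server)) W
                   + ι (multiplicity m j client) * when ((k , i , server) ⟶ⱽ? (m , j , client)) W
                   ≡ when (toℕ m ℕ.≟ suc (toℕ k)) (inner m j)
      term m j = trans
        (cong₂ _+_ (pull (toℕ m ℕ.≟ suc (toℕ k)) (toℕ i ℕ.≤? toℕ (opposite j)) (ι (multiplicity m j server)))
                   (pull (toℕ m ℕ.≟ suc (toℕ k)) (toℕ i ℕ.≤? toℕ j) (ι (multiplicity m j client))))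
        (sym (when-+ (toℕ m ℕ.≟ suc (toℕ k)) (ι (multiplicity m j server) * when (toℕ i ℕ.≤? toℕ (opposite j)) W) _))

    -- A later server spreads `width i`/L in all, and L = `width i` + (K - i) makes this its room.
    -- In generation 0 the room is 1, and the smaller number of servers raises the weight of each
    -- accordingly.
    saturatedⱽ : ∀ {a b} → a ⟶ⱽ b → ∑[ v < size ] when (a ⟶ⱽ? vertex v) (weight a) ≡ 1# - inflowⱽ a
    saturatedⱽ {k , i , server} {zero , _} (() , _)
    saturatedⱽ {zero , i , server} {suc l , _} (l≡1+k , _) = begin
      _ ≡⟨ outflow zero i {l} l≡1+k (weight (zero , i , server)) ⟩
      ι (width i ℕ.* pool i) * (1/ L * 1/ (width i ℕ.* stock i))
        ≡⟨ cong (λ m → m * (1/ L * 1/ (width i ℕ.* stock i))) (trans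
             (cong ι (width-*-pool i))
             (ι-* L (width i ℕ.* stock i))) ⟩
      ι L * ι (width i ℕ.* stock i) * (1/ L * 1/ (width i ℕ.* stock i))
        ≡⟨ solve 4 (λ a b c d → a :* b :* (c :* d) := (a :* c) :* (b :* d)) refl (ι L) (ι (width i ℕ.* stock i)) (1/ L) (1/ (width i ℕ.* stock i)) ⟩
      (ι L * 1/ L) * (ι (width i ℕ.* stock i) * 1/ (width i ℕ.* stock i))
        ≡⟨ cong₂ _*_ (*-1/ 1≤L) (*-1/ (1≤servers zero i)) ⟩
      1# * 1#
        ≡⟨ solve 0 (# 1 :* # 1 := # 1 :- # 0) refl ⟩
      1# - 0#
        ≡⟨ cong (λ z → 1# - z) (inflow-zero i server) ⟨
      1# - inflowⱽ (zero , i , server) ∎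
    saturatedⱽ {suc k , i , server} {suc l , _} (l≡1+k , _) = begin
      _ ≡⟨ outflow (suc k) i {l} l≡1+k (weight (suc k , i , server)) ⟩
      ι (width i ℕ.* pool i) * (1/ L * 1/ pool i)
        ≡⟨ cong (_* (1/ L * 1/ pool i)) (ι-* (width i) (pool i)) ⟩
      ι (width i) * ι (pool i) * (1/ L * 1/ pool i)
        ≡⟨ solve 4 (λ a b c d → a :* b :* (c :* d) := a :* c :* (b :* d)) refl (ι (width i)) (ι (pool i)) (1/ L) (1/ pool i) ⟩
      ι (width i) * 1/ L * (ι (pool i) * 1/ pool i)
        ≡⟨ cong (ι (width i) * 1/ L *_) (*-1/ (1≤pool i)) ⟩
      ι (width i) * 1/ L * 1#
        ≡⟨ solve 3 (λ a b c → a :* b :* # 1 := (a :+ c) :* b :- c :* b) refl (ι (width i)) (1/ L) (ι (suc (toℕ (opposite i)))) ⟩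
      (ι (width i) + ι (suc (toℕ (opposite i)))) * 1/ L - ι (suc (toℕ (opposite i))) * 1/ L
        ≡⟨ cong₂ (λ a b → a * 1/ L - b) (trans (sym (ι-+ (width i) (suc (toℕ (opposite i))))) (cong ι
             (trans (cong suc (ℕ.+-assoc E (toℕ i) _)) (cong (λ m → suc (E ℕ.+ m)) (toℕ+opposite i))))) (sym (inflow-suc k i server)) ⟩
      ι L * 1/ L - inflowⱽ (suc k , i , server)
        ≡⟨ cong (_- inflowⱽ (suc k , i , server)) (*-1/ 1≤L) ⟩
      1# - inflowⱽ (suc k , i , server) ∎

    ⟶⇒index< : ∀ {u v} → vertex u ⟶ⱽ vertex v → u Fin.< v
    ⟶⇒index< {u} {v} u⟶v with Fin.<-cmp u v
    ... | tri< u<v _ _ = u<v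
    ... | tri≈ _ refl _ = contradiction u⟶v (irreflexive (vertex u))
      where
      irreflexive : ∀ a → ¬ (a ⟶ⱽ a)
      irreflexive (k , i , server) (k≡1+k , _) = ℕ.1+n≢n (sym k≡1+k)
    ... | tri> _ _ v<u = contradiction (AllPairs-lookup vertices-sorted v<u) (upward u⟶v)
      where
      upward : ∀ {a b} → a ⟶ⱽ b → ¬ (b ≼ a)
      upward {k , i , server} (l≡1+k , _) (inj₁ l<k)        = ℕ.<⇒≱ l<k (subst (toℕ k ℕ.≤_) (sym l≡1+k) (ℕ.n≤1+n _))
      upward {k , i , server} (l≡1+k , _) (inj₂ (refl , _)) = ℕ.1+n≢n (sym l≡1+k)

    -- Within a generation the out-neighbourhoods shrink as the group index grows, so an earlier
    -- server reaches all out-neighbours of a later one. Servers of different generations have no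
    -- out-neighbour in common.
    synchronousⱽ : ∀ {t u v v′} → t ≼ u → u ⟶ⱽ v → u ⟶ⱽ v′ → t ⟶ⱽ v → t ⟶ⱽ v′
    synchronousⱽ {_ , _ , server} {_ , _ , server} (inj₁ t<u) (v≡1+u , _) _ (v≡1+t , _) =
      contradiction (ℕ.suc-injective (trans (sym v≡1+t) v≡1+u)) (ℕ.<⇒≢ t<u)
    synchronousⱽ {_ , _ , server} {_ , _ , server} (inj₂ (refl , it≤iu)) _ (v′≡1+u , iu≤) _ =
      v′≡1+u , ℕ.≤-trans it≤iu iu≤

    graph : SimpleGraph size
    graph = record
      { _~_ = λ u v → vertex u ⟶ⱽ vertex v ⊎ vertex v ⟶ⱽ vertex u
      ; _~?_ = λ u v → (vertex u ⟶ⱽ? vertex v) ⊎-dec (vertex v ⟶ⱽ? vertex u)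
      ; ~-sym = swap
      ; ~-irrefl = λ { {u} refl (inj₁ u⟶u) → ℕ.<-irrefl refl (⟶⇒index< {u} {u} u⟶u)
                     ; {u} refl (inj₂ u⟶u) → ℕ.<-irrefl refl (⟶⇒index< {u} {u} u⟶u) } }

    balanced : BalancedOrientation (static graph)
    balanced = record
      { _⟶_ = λ u v → vertex u ⟶ⱽ vertex v
      ; _⟶?_ = λ u v → vertex u ⟶ⱽ? vertex v
      ; w = λ u → weight (vertex u)
      ; w-nonNeg = λ u → weight-nonNeg (vertex u)
      ; orient = λ u~v → u~v
      ; ⟶⇒~ = inj₁
      ; ⟶⇒< = λ {u} {v} u⟶v → subst₂ ℕ._<_ (sym (static-deadline graph u)) (sym (static-deadline graph v))
          (ℕ.+-monoʳ-< size (⟶⇒index< {u} {v} u⟶v))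
      ; inflow≤1 = λ v → inflowⱽ≤1 (vertex v)
      ; saturated = saturatedⱽ
      ; synchronous = λ {t} {u} {v} {v′} t<u → synchronousⱽ {vertex t} {vertex u} {vertex v} {vertex v′} (AllPairs-lookup vertices-sorted
          (ℕ.+-cancelˡ-< size _ _ (subst₂ ℕ._<_ (static-deadline graph t) (static-deadline graph u) t<u))) }

    -- The optimum of the layered instance

    infix 4 _⋈_ _⋈?_
    _⋈_ : Vertex → Vertex → Set
    (k , i , server) ⋈ (k′ , i′ , client) = toℕ k′ ≡ suc (toℕ k) × i ≡ i′
    (k , i , server) ⋈ (k′ , i′ , server) = ⊥
    (k , i , client) ⋈ _ = ⊥

    _⋈?_ : ∀ a b → Dec (a ⋈ b)
    (k , i , server) ⋈? (k′ , i′ , client) = (toℕ k′ ℕ.≟ suc (toℕ k)) ×-dec (i Fin.≟ i′)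
    (k , i , server) ⋈? (k′ , i′ , server) = no λ ()
    (k , i , client) ⋈? _ = no λ ()

    ⋈⇒⟶ : ∀ {a b} → a ⋈ b → a ⟶ⱽ b
    ⋈⇒⟶ {_ , _ , server} {_ , _ , client} (l≡1+k , refl) = l≡1+k , ℕ.≤-refl

    -- Each server is spread evenly over all clients of its group in the next generation, which
    -- avoids choosing a bijection between copies. Generation 0 has at most as many servers as
    -- clients facing it, so those clients need not be filled.
    amount : Vertex → Vertex → Carrier
    amount a b = when (a ⋈? b) (1/ pool (proj₁ (proj₂ a)))

    amount-nonNeg : ∀ a b → 0# ≤ amount a b
    amount-nonNeg a b = when-nonNeg (a ⋈? b) λ _ → 1/-nonNeg (pool (proj₁ (proj₂ a)))

    amount-into-server : ∀ a k i → amount a (k , i , server) ≡ 0#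
    amount-into-server (_ , _ , server) k i = refl
    amount-into-server (_ , _ , client) k i = refl

    -- The servers outside the last generation form a vertex cover, since every edge starts at one
    -- of them, and `assignment` matches each of them completely.
    coverⱽ : Vertex → Carrier
    coverⱽ (k , i , server) = when (toℕ k ℕ.<? G) 1#
    coverⱽ (k , i , client) = 0#

    coverⱽ-nonNeg : ∀ a → 0# ≤ coverⱽ a
    coverⱽ-nonNeg (k , i , server) = when-nonNeg (toℕ k ℕ.<? G) λ _ → 0≤1
    coverⱽ-nonNeg (k , i , client) = ≤-refl

    coverⱽ≤1 : ∀ a → coverⱽ a ≤ 1#
    coverⱽ≤1 (k , i , server) = when-≤ (toℕ k ℕ.<? G) 0≤1
    coverⱽ≤1 (k , i , client) = 0≤1

    coverⱽ-source : ∀ {a b} → a ⟶ⱽ b → coverⱽ a ≡ 1#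
    coverⱽ-source {k , i , server} {l , _} (l≡1+k , _) = when-yes (toℕ k ℕ.<? G)
      (ℕ.s≤s⁻¹ (subst (ℕ._< suc G) l≡1+k (Fin.toℕ<n l)))

    private
      pull : ∀ {p q} {P : Set p} {Q : Set q} (P? : Dec P) (Q? : Dec Q) c w →
             c * when (P? ×-dec Q?) w ≡ when P? (when Q? (c * w))
      pull P? Q? c w = trans (sym (when-*ˡ (P? ×-dec Q?) c w)) (when-× P? Q?)

    given : ∀ a → ∑[ v < size ] amount a (vertex v) ≡ coverⱽ a
    given (k , i , client) = sum-0 {size} λ _ → refl
    given (k , i , server) = begin
      ∑[ v < size ] amount (k , i , server) (vertex v)
        ≡⟨ sum-vertices (amount (k , i , server)) ⟩
      ∑[ m < suc G ] ∑[ j < K ] (ι (multiplicity m j server) * 0# + ι (multiplicity m j client) * amount (k , i , server) (m , j , client))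
        ≡⟨ sum-cong-≗ {suc G} (λ m → trans (sum-cong-≗ {K} (term m)) (trans
             (when-sum {n = K} (toℕ m ℕ.≟ suc (toℕ k)) (λ j → when (i Fin.≟ j) (ι (multiplicity m j client) * 1/ pool i)))
             (when-cong (toℕ m ℕ.≟ suc (toℕ k)) λ _ →
               sum-unique (λ j → i Fin.≟ j) (λ j → ι (multiplicity m j client) * 1/ pool i) refl sym))) ⟩
      ∑[ m < suc G ] when (toℕ m ℕ.≟ suc (toℕ k)) (ι (multiplicity m i client) * 1/ pool i)
        ≡⟨ by-cases (toℕ k ℕ.<? G) ⟩
      when (toℕ k ℕ.<? G) 1# ∎
      where
      term : ∀ m j → ι (multiplicity m j server) * 0# + ι (multiplicity m j client) * amount (k , i , server) (m , j , client)
                   ≡ when (toℕ m ℕ.≟ suc (toℕ k)) (when (i Fin.≟ j) (ι (multiplicity m j client) * 1/ pool i))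
      term m j = trans
        (cong₂ _+_ (zeroʳ (ι (multiplicity m j server)))
          (pull (toℕ m ℕ.≟ suc (toℕ k)) (i Fin.≟ j) (ι (multiplicity m j client)) (1/ pool i)))
        (+-identityˡ _)
      by-cases : (k<G : Dec (toℕ k ℕ.< G)) →
        ∑[ m < suc G ] when (toℕ m ℕ.≟ suc (toℕ k)) (ι (multiplicity m i client) * 1/ pool i) ≡ when k<G 1#
      by-cases (yes k<G) = trans
        (sum-unique (λ m → toℕ m ℕ.≟ suc (toℕ k)) (λ m → ι (multiplicity m i client) * 1/ pool i) {suc l} l≡
          (λ m≡ → Fin.toℕ-injective (trans m≡ (sym l≡))))
        (*-1/ (1≤pool i))
        where
        l : Fin G
        l = Fin.fromℕ< k<G
        l≡ : toℕ (Fin.suc l) ≡ suc (toℕ k)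
        l≡ = cong suc (Fin.toℕ-fromℕ< k<G)
      by-cases (no k≮G) = sum-none (λ m → toℕ m ℕ.≟ suc (toℕ k)) (λ m → ι (multiplicity m i client) * 1/ pool i)
        (λ m m≡1+k → k≮G (ℕ.s≤s⁻¹ (subst (ℕ._< suc G) m≡1+k (Fin.toℕ<n m))))

    received : Vertex → Carrier
    received b = ∑[ u < size ] amount (vertex u) b

    received-client : ∀ k i → received (k , i , client) ≤ 1#
    received-client k i = subst (_≤ 1#) (sym (begin
      received (k , i , client)
        ≡⟨ sum-vertices (λ a → amount a (k , i , client)) ⟩
      ∑[ l < suc G ] ∑[ j < K ] (ι (multiplicity l j server) * amount (l , j , server) (k , i , client) + ι (multiplicity l j client) * 0#)
        ≡⟨ sum-cong-≗ {suc G} (λ l → trans (sum-cong-≗ {K} (term l)) (trans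
             (when-sum {n = K} (toℕ k ℕ.≟ suc (toℕ l)) (λ j → when (j Fin.≟ i) (share′ l j)))
             (when-cong (toℕ k ℕ.≟ suc (toℕ l)) λ _ → sum-point (share′ l) i))) ⟩
      ∑[ l < suc G ] when (toℕ k ℕ.≟ suc (toℕ l)) (share′ l i) ∎)) (bound k)
      where
      share′ : Fin (suc G) → Fin K → Carrier
      share′ l j = ι (multiplicity l j server) * 1/ pool j
      term : ∀ l j → ι (multiplicity l j server) * amount (l , j , server) (k , i , client) + ι (multiplicity l j client) * 0#
                   ≡ when (toℕ k ℕ.≟ suc (toℕ l)) (when (j Fin.≟ i) (share′ l j))
      term l j = trans
        (cong₂ _+_ (pull (toℕ k ℕ.≟ suc (toℕ l)) (j Fin.≟ i) (ι (multiplicity l j server)) (1/ pool j))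
          (zeroʳ (ι (multiplicity l j client))))
        (+-identityʳ _)
      bound : ∀ k → ∑[ l < suc G ] when (toℕ k ℕ.≟ suc (toℕ l)) (share′ l i) ≤ 1#
      bound zero    = subst (_≤ 1#) (sym (sum-none (λ l → 0 ℕ.≟ suc (toℕ l)) (λ (l : Fin (suc G)) → share′ l i) λ _ ())) 0≤1
      bound (suc k) = subst (_≤ 1#)
        (sym (sum-unique (λ l → suc (toℕ k) ℕ.≟ suc (toℕ l)) (λ l → share′ l i) {inject₁ k}
          (cong suc (sym (Fin.toℕ-inject₁ k)))
          (λ eq → Fin.toℕ-injective (trans (sym (ℕ.suc-injective eq)) (sym (Fin.toℕ-inject₁ k))))))
        (≤-trans (*-monoʳ-≤ (1/-nonNeg (pool i)) (ι-mono-≤ (servers≤pool (inject₁ k) i))) (≤-reflexive (*-1/ (1≤pool i))))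

    assignment : EdgeValues size
    assignment u v = amount (vertex u) (vertex v) + amount (vertex v) (vertex u)

    level-assignment : ∀ v → level assignment v ≡ coverⱽ (vertex v) + received (vertex v)
    level-assignment v = trans (∑-distrib-+ {size} (λ w → amount (vertex v) (vertex w)) (λ w → amount (vertex w) (vertex v)))
      (cong (_+ received (vertex v)) (given (vertex v)))

    assignment-matching : IsFractionalMatching graph assignment
    assignment-matching = record
      { symmetric = λ u v → +-comm _ _
      ; support = λ u v u≁v → trans (cong₂ _+_
          (when-no (vertex u ⋈? vertex v) (λ m → u≁v (inj₁ (⋈⇒⟶ m))))
          (when-no (vertex v ⋈? vertex u) (λ m → u≁v (inj₂ (⋈⇒⟶ m))))) (+-identityˡ 0#)
      ; nonNeg = λ u v → +-nonNeg (amount-nonNeg (vertex u) (vertex v)) (amount-nonNeg (vertex v) (vertex u))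
      ; level≤1 = λ v → subst (_≤ 1#) (sym (level-assignment v)) (bound (vertex v)) }
      where
      bound : ∀ a → coverⱽ a + received a ≤ 1#
      bound (k , i , server) = subst (_≤ 1#)
        (sym (trans (cong (coverⱽ (k , i , server) +_) (sum-0 {size} λ u → amount-into-server (vertex u) k i)) (+-identityʳ _)))
        (coverⱽ≤1 (k , i , server))
      bound (k , i , client) = subst (_≤ 1#) (sym (+-identityˡ _)) (received-client k i)

    optimum : Carrier
    optimum = ∑[ v < size ] coverⱽ (vertex v)

    -- The matching meets the size of the vertex cover, so both are optimal by weak duality.
    isOPT : IsOPT graph optimum
    isOPT = record
      { attained = assignment , assignment-matching , halve (trans (sym (value-double assignment-matching)) total)
      ; upperBound = λ x M → *-cancelˡ-≤ 0<2 (subst₂ _≤_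
          (trans (*-identityˡ _) (trans (value-double M) (double (value x)))) (double optimum)
          (weak-duality M {1#} (λ v → coverⱽ-nonNeg (vertex v)) covered)) }
      where
      double : ∀ a → a + a ≡ 2# * a
      double = solve 1 (λ a → a :+ a := # 2 :* a) refl
      halve : ∀ {a b} → a + a ≡ b + b → a ≡ b
      halve {a} {b} eq = *-cancelˡ-≡ (≢-sym (proj₂ 0<2)) (trans (sym (double a)) (trans eq (double b)))
      covered : ∀ {u v} → SimpleGraph._~_ graph u v → 1# ≤ coverⱽ (vertex u) + coverⱽ (vertex v)
      covered {u} {v} (inj₁ u⟶v) = subst (_≤ coverⱽ (vertex u) + coverⱽ (vertex v)) (coverⱽ-source u⟶v)
        (x≤x+y (coverⱽ-nonNeg (vertex v)))
      covered {u} {v} (inj₂ v⟶u) = subst₂ _≤_ (coverⱽ-source v⟶u) (+-comm (coverⱽ (vertex v)) (coverⱽ (vertex u)))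
        (x≤x+y (coverⱽ-nonNeg (vertex u)))
      total : sum (level assignment) ≡ optimum + optimum
      total = begin
        sum (level assignment)
          ≡⟨ sum-cong-≗ {size} level-assignment ⟩
        ∑[ v < size ] (coverⱽ (vertex v) + received (vertex v))
          ≡⟨ ∑-distrib-+ {size} (λ v → coverⱽ (vertex v)) (λ v → received (vertex v)) ⟩
        optimum + ∑[ v < size ] received (vertex v)
          ≡⟨ cong (optimum +_) (∑-comm {size} {size} (λ v u → amount (vertex u) (vertex v))) ⟩
        optimum + ∑[ u < size ] ∑[ v < size ] amount (vertex u) (vertex v)
          ≡⟨ cong (optimum +_) (sum-cong-≗ {size} λ u → given (vertex u)) ⟩
        optimum + optimum ∎

    -- Comparing Water-Filling with the optimum

    pools : Carrier
    pools = ∑[ i < K ] ι (pool i)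

    0<pools : 0# < pools
    0<pools = <-≤-trans (ι-pos (1≤pool i)) (term≤sum {K} (λ j → ι-nonNeg (pool j)) i)
      where
      i : Fin K
      i = Fin.fromℕ< (SquareTriangular.1≤K ST)

    -- The optimum pairs servers with clients of the next generation, but here a server is added to
    -- a client of its own generation. All later generations look alike, so this gives (K + 1)/L per
    -- pair as well.
    sum-inflow : ∑[ v < size ] inflowⱽ (vertex v) ≡ ι G * (ι (suc K) * 1/ L * pools)
    sum-inflow = begin
      ∑[ v < size ] inflowⱽ (vertex v)
        ≡⟨ sum-vertices inflowⱽ ⟩
      ∑[ i < K ] (ι (width i ℕ.* stock i) * inflowⱽ (zero , i , server) + 0# * inflowⱽ (zero , i , client))
        + ∑[ k < G ] ∑[ i < K ] (ι (pool i) * inflowⱽ (suc k , i , server) + ι (pool i) * inflowⱽ (suc k , i , client))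
        ≡⟨ cong₂ _+_ (sum-0 {K} first) (sum-cong-≗ {G} λ k → trans (sum-cong-≗ {K} (later k)) (sum-* (ι (suc K) * 1/ L) (λ i → ι (pool i)))) ⟩
      0# + ∑[ k < G ] (ι (suc K) * 1/ L * pools)
        ≡⟨ +-identityˡ _ ⟩
      ∑[ k < G ] (ι (suc K) * 1/ L * pools)
        ≡⟨ sum-const G (ι (suc K) * 1/ L * pools) ⟩
      ι G * (ι (suc K) * 1/ L * pools) ∎
      where
      first : ∀ i → ι (width i ℕ.* stock i) * inflowⱽ (zero , i , server) + 0# * inflowⱽ (zero , i , client) ≡ 0#
      first i = trans (cong₂ (λ a b → ι (width i ℕ.* stock i) * a + 0# * b) (inflow-zero i server) (inflow-zero i client))
        (solve 1 (λ a → a :* # 0 :+ # 0 :* # 0 := # 0) refl (ι (width i ℕ.* stock i)))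
      later : ∀ k i → ι (pool i) * inflowⱽ (suc k , i , server) + ι (pool i) * inflowⱽ (suc k , i , client)
                    ≡ ι (suc K) * 1/ L * ι (pool i)
      later k i = begin
        ι (pool i) * inflowⱽ (suc k , i , server) + ι (pool i) * inflowⱽ (suc k , i , client)
          ≡⟨ cong₂ (λ a b → ι (pool i) * a + ι (pool i) * b) (inflow-suc k i server) (inflow-suc k i client) ⟩
        ι (pool i) * (ι (suc (toℕ (opposite i))) * 1/ L) + ι (pool i) * (ι (suc (toℕ i)) * 1/ L)
          ≡⟨ solve 4 (λ q a b l → q :* (a :* l) :+ q :* (b :* l) := (b :+ a) :* l :* q) refl
               (ι (pool i)) (ι (suc (toℕ (opposite i)))) (ι (suc (toℕ i))) (1/ L) ⟩
        (ι (suc (toℕ i)) + ι (suc (toℕ (opposite i)))) * 1/ L * ι (pool i)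
          ≡⟨ cong (λ a → a * 1/ L * ι (pool i)) (trans (sym (ι-+ (suc (toℕ i)) (suc (toℕ (opposite i)))))
               (cong (λ m → ι (suc m)) (toℕ+opposite i))) ⟩
        ι (suc K) * 1/ L * ι (pool i) ∎

  -- Of the g + 1 generations in the cover, generation 0 is smaller and is simply discarded. Against
  -- the g + 1 generations with inflow this costs a factor (g + 1)/g.
  optimum-bound : ∀ {E K} (ST : SquareTriangular E K) g → let open Layered ST (suc g) in ι g * pools ≤ optimum
  optimum-bound {E} {K} ST g = subst₂ _≤_ (+-identityˡ _) (sym (sum-vertices coverⱽ)) (+-mono-≤
    (sum-nonNeg {K} λ i → +-nonNeg (*-nonNeg (ι-nonNeg (multiplicity zero i server)) 0≤1) (≤-reflexive (sym (zeroˡ 0#))))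
    (≤-reflexive (begin
      ι g * pools
        ≡⟨ bounded-count g pools ⟨
      ∑[ k < suc g ] when (toℕ k ℕ.<? g) pools
        ≡⟨ sum-cong-≗ {suc g} (λ k → sym (when-sum {n = K} (toℕ k ℕ.<? g) (λ i → ι (pool i)))) ⟩
      ∑[ k < suc g ] ∑[ i < K ] when (toℕ k ℕ.<? g) (ι (pool i))
        ≡⟨ sum-cong-≗ {suc g} (λ k → sum-cong-≗ {K} (term k)) ⟩
      ∑[ k < suc g ] ∑[ i < K ] (ι (pool i) * coverⱽ (suc k , i , server) + ι (pool i) * 0#) ∎)))
    where
    open Counts ST using (pool)
    open Layered ST (suc g)
    term : ∀ k i → when (toℕ k ℕ.<? g) (ι (pool i)) ≡ ι (pool i) * when (suc (toℕ k) ℕ.<? suc g) 1# + ι (pool i) * 0#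
    term k i = begin
      when (toℕ k ℕ.<? g) (ι (pool i))
        ≡⟨ when-⇔ (toℕ k ℕ.<? g) (suc (toℕ k) ℕ.<? suc g) {ι (pool i)} ℕ.s≤s ℕ.s≤s⁻¹ ⟩
      when (suc (toℕ k) ℕ.<? suc g) (ι (pool i))
        ≡⟨ cong (when (suc (toℕ k) ℕ.<? suc g)) (*-identityʳ (ι (pool i))) ⟨
      when (suc (toℕ k) ℕ.<? suc g) (ι (pool i) * 1#)
        ≡⟨ when-*ˡ (suc (toℕ k) ℕ.<? suc g) (ι (pool i)) 1# ⟩
      ι (pool i) * when (suc (toℕ k) ℕ.<? suc g) 1#
        ≡⟨ trans (cong (ι (pool i) * when (suc (toℕ k) ℕ.<? suc g) 1# +_) (zeroʳ (ι (pool i)))) (+-identityʳ _) ⟨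
      ι (pool i) * when (suc (toℕ k) ℕ.<? suc g) 1# + ι (pool i) * 0# ∎

  -- Letting the instances grow

  1≤√2 : 1# ≤ √2
  1≤√2 = square-cancel-≤ 0≤√2 (subst₂ _≤_ (sym (*-identityˡ 1#)) (sym √2*√2≡2) (x≤x+y 0≤1))

  module _ {E K : ℕ} (ST : SquareTriangular E K) where
    open Counts ST
    open SquareTriangular ST

    -- K + 1 and `long-side` add up to 2L + 1, and `long-side` is at least √2 L. So (K + 1)/L
    -- exceeds 2 - √2 by at most 1/L.
    side-bound : ι (suc K) ≤ Γ₀ * ι L + 1#
    side-bound = ≤-gap (D - √2 * ι L) (nonNeg-difference √2L≤D) (begin
      ι (suc K) + (D - √2 * ι L)
        ≡⟨ solve 3 (λ k d m → k :+ (d :- m) := k :+ d :- m) refl (ι (suc K)) D (√2 * ι L) ⟩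
      ι (suc K) + D - √2 * ι L
        ≡⟨ cong (λ z → z - √2 * ι L) (trans (sym (ι-+ (suc K) _)) (trans (cong ι (long-side-sum ST)) (cong (1# +_) (ι-+ L L)))) ⟩
      1# + (ι L + ι L) - √2 * ι L
        ≡⟨ solve 2 (λ l s → # 1 :+ (l :+ l) :- s :* l := (# 2 :- s) :* l :+ # 1) refl (ι L) √2 ⟩
      Γ₀ * ι L + 1# ∎)
      where
      D : Carrier
      D = ι (long-side ST)
      √2L≤D : √2 * ι L ≤ D
      √2L≤D = square-cancel-≤ (ι-nonNeg (long-side ST)) (subst₂ _≤_
        (begin
          ι (2 ℕ.* (L ℕ.* L)) ≡⟨ trans (ι-* 2 (L ℕ.* L)) (cong (ι 2 *_) (ι-* L L)) ⟩
          ι 2 * (ι L * ι L)   ≡⟨ solve 1 (λ a → (# 1 :+ (# 1 :+ # 0)) :* a := # 2 :* a) refl (ι L * ι L) ⟩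
          2# * (ι L * ι L)    ≡⟨ cong (_* (ι L * ι L)) √2*√2≡2 ⟨
          √2 * √2 * (ι L * ι L) ≡⟨ solve 2 (λ s l → s :* s :* (l :* l) := s :* l :* (s :* l)) refl √2 (ι L) ⟩
          √2 * ι L * (√2 * ι L) ∎)
        (ι-* (long-side ST) (long-side ST))
        (ι-mono-≤ (long-side-bound ST)))

    -- With L + 1 generations after generation 0, the relative boundary loss is 1/L, of the same
    -- order as the error in `side-bound`.
    ratio-bound : ∀ {Γ} → 0# ≤ Γ → Competitive WaterFilling Γ → Γ * ι L * ι L ≤ ι (suc L) * ι (suc K)
    ratio-bound {Γ} 0≤Γ competitive = *-cancelˡ-≤ 0<pools (subst₂ _≤_
        (solve 3 (λ g l p → g :* (l :* p) :* l := p :* (g :* l :* l)) refl Γ (ι L) pools)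
        (begin
          ι (suc L) * (ι (suc K) * 1/ L * pools) * ι L
            ≡⟨ solve 5 (λ m k i p l → m :* (k :* i :* p) :* l := p :* (m :* k) :* (l :* i)) refl (ι (suc L)) (ι (suc K)) (1/ L) pools (ι L) ⟩
          pools * (ι (suc L) * ι (suc K)) * (ι L * 1/ L)
            ≡⟨ trans (cong (pools * (ι (suc L) * ι (suc K)) *_) (*-1/ 1≤L)) (*-identityʳ _) ⟩
          pools * (ι (suc L) * ι (suc K)) ∎)
        (*-monoʳ-≤ (ι-nonNeg L) (≤-trans (*-monoˡ-≤ 0≤Γ (optimum-bound ST L)) value-bound)))
      where
      open Layered ST (suc L)
      run : ∃[ ρ ] WaterFilling {static graph} ρ
      run = waterFilling-exists (static graph)
      value-bound : Γ * optimum ≤ ι (suc L) * (ι (suc K) * 1/ L * pools)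
      value-bound = subst (Γ * optimum ≤_) (trans (balanced-value balanced (proj₁ run) (proj₂ run)) sum-inflow)
        (competitive (static graph) (proj₁ run) (proj₂ run) optimum isOPT)

    -- The two previous bounds give Γ L² ≤ (L + 1)(Γ₀ L + 1); since Γ₀ ≤ 1 ≤ L, the right side is at
    -- most Γ₀ L² + 3L, and one factor L cancels.
    excess-bound : ∀ {Γ} → 0# ≤ Γ → Competitive WaterFilling Γ → (Γ - Γ₀) * ι L ≤ 1# + 2#
    excess-bound {Γ} 0≤Γ competitive = *-cancelˡ-≤ 0<l
      (≤-gap (slack + ((1# - Γ₀) * l + (l - 1#))) 
        (+-nonNeg (nonNeg-difference (≤-trans (ratio-bound 0≤Γ competitive) (*-monoˡ-≤ (ι-nonNeg (suc L)) side-bound)))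
          (+-nonNeg (*-nonNeg (nonNeg-difference Γ₀≤1) (proj₁ 0<l)) (nonNeg-difference 1≤l)))
        (solve 3 (λ g c l → l :* ((g :- c) :* l)
            :+ ((# 1 :+ l) :* (c :* l :+ # 1) :- g :* l :* l :+ ((# 1 :- c) :* l :+ (l :- # 1)))
            := l :* (# 1 :+ # 2)) refl Γ Γ₀ l))
      where
      l slack : Carrier
      l = ι L
      slack = ι (suc L) * (Γ₀ * l + 1#) - Γ * l * l
      1≤l : 1# ≤ l
      1≤l = x≤x+y (ι-nonNeg (E ℕ.+ K))
      0<l : 0# < l
      0<l = <-≤-trans 0<1 1≤l
      Γ₀≤1 : Γ₀ ≤ 1#
      Γ₀≤1 = ≤-gap (√2 - 1#) (nonNeg-difference 1≤√2)
        (solve 1 (λ s → # 2 :- s :+ (s :- # 1) := # 1) refl √2)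

  waterFilling-tight : ∀ Γ → 2# - √2 < Γ → ¬ Competitive WaterFilling Γ
  waterFilling-tight Γ Γ₀<Γ competitive with inverse (Γ - Γ₀) η≢0
    where
    η≢0 : Γ - Γ₀ ≢ 0#
    η≢0 η≡0 = proj₂ Γ₀<Γ (sym (trans (solve 2 (λ g c → g := g :- c :+ c) refl Γ Γ₀)
      (trans (cong (_+ Γ₀) η≡0) (+-identityˡ Γ₀))))
  -- The 4 beats the 3 in `excess-bound`: L ≥ E ≥ k ≥ 4/η gives η L ≥ 4.
  ... | η⁻¹ , ηη⁻¹≡1 with archimedean (4# * η⁻¹)
  ...   | k , 4η⁻¹≤k with largeSquareTriangular k
  ...     | E , K , k≤E , ST = <⇒≱ 3<4 (≤-trans 4≤ηL (excess-bound ST (≤-trans 0≤Γ₀ (proj₁ Γ₀<Γ)) competitive))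
    where
    η : Carrier
    η = Γ - Γ₀
    L : ℕ
    L = Counts.L ST
    3<4 : 1# + 2# < 4#
    3<4 = (≤-gap 1# 0≤1 (solve 0 (# 1 :+ # 2 :+ # 1 := # 2 :* # 2) refl)) , λ 3≡4 → 1≢0 (begin
      1#               ≡⟨ solve 0 (# 1 := # 2 :* # 2 :- (# 1 :+ # 2)) refl ⟩
      4# - (1# + 2#)   ≡⟨ cong (λ z → 4# - z) 3≡4 ⟩
      4# - 4#          ≡⟨ -‿inverseʳ 4# ⟩
      0#               ∎)
    4≤ηL : 4# ≤ η * ι L
    4≤ηL = subst (_≤ η * ι L) (begin
        η * (4# * η⁻¹) ≡⟨ solve 3 (λ e f i → e :* (f :* i) := f :* (e :* i)) refl η 4# η⁻¹ ⟩
        4# * (η * η⁻¹) ≡⟨ cong (4# *_) ηη⁻¹≡1 ⟩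
        4# * 1#        ≡⟨ *-identityʳ 4# ⟩
        4#             ∎)
      (*-monoˡ-≤ (nonNeg-difference (proj₁ Γ₀<Γ))
        (≤-trans 4η⁻¹≤k (ι-mono-≤ (ℕ.≤-trans k≤E (ℕ.m≤n⇒m≤1+n (ℕ.m≤m+n E K))))))

theorem1p1 : (ℝ : RealField) →
    let open RealField ℝ
        open FullyOnlineMatching ℝ
    in (∀ (I : Instance) → ∃[ ρ ] WaterFilling {I} ρ)
       × Competitive WaterFilling (2# - √2)
       × (∀ Γ → 2# - √2 < Γ → ¬ Competitive WaterFilling Γ)
theorem1p1 ℝ = waterFilling-exists ℝ , waterFilling-competitive ℝ , waterFilling-tight ℝ
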